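{- $\mathsf{Almost\mbox{ - }EC}\equiv_{\mathrm W}(\mathsf C_{\mathbb N}\rightarrow\lim)$.
   Context: A represented space $\mathbf X=(X,\delta_X)$ is a set $X$ with a partial surjection $\delta_X:\subseteq\mathbb N^{\mathbb N}\to X$ (the symbol $\subseteq$ marks possibly partial functions). A multi-valued function $f:\subseteq\mathbf X\rightrightarrows\mathbf Y$ assigns to each $x\in\mathrm{dom}(f)\subseteq X$ a nonempty set $f(x)\subseteq Y$. Composition: $z\in(f\circ g)(x)$ iff $g(x)\subseteq\mathrm{dom}(f)$ and $z\in f(y)$ for some $y\in g(x)$ (with $x\in\mathrm{dom}(g)$). $F:\subseteq\mathbb N^{\mathbb N}\to\mathbb N^{\mathbb N}$ is a realizer of $f$, $F\vdash f$, if $\delta_YF(p)\in f\delta_X(p)$ for all $p\in\mathrm{dom}(f\delta_X)$. $f\leq_{\mathrm W}g$ iff there are computable $K,H:\subseteq\mathbb N^{\mathbb N}\to\mathbb N^{\mathbb N}$ with $K\langle\mathrm{id},GH\rangle\vdash f$ for all $G\vdash g$; $\equiv_{\mathrm W}$ is the induced equivalence. Space $\mathcal M(\mathbf X,\mathbf Y)$: fix a universal Turing machine; $\Phi_p:\subseteq\mathbb N^{\mathbb N}\to\mathbb N^{\mathbb N}$ is the partial function it computes with first input $p$, i.e. $\Phi_p(q)=r$ iff on input $\langle p,q\rangle$ it produces the infinite output $r$. Let $\delta_X^{\mathrm{cyl}}\langle p,q\rangle:=\delta_X(p)$, $\Phi_p^{\mathbf X,\mathbf Y}:=\delta_Y\circ\Phi_p\circ(\delta_X^{\mathrm{cyl}})^{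 -1}$. $\mathcal M(\mathbf X,\mathbf Y)$ is the represented space of all $\Phi_p^{\mathbf X,\mathbf Y}$, with $p$ as a name. Implication: for $f:\subseteq\mathbf U\rightrightarrows\mathbf V$ and $g:\subseteq\mathbf X\rightrightarrows\mathbf Y$ with $\mathrm{dom}(g)\neq\emptyset$, $(g\rightarrow f):\subseteq\mathbf U\rightrightarrows\mathcal M(\mathbf Y,\mathbf V)\times\mathbf X$ has domain $\mathrm{dom}(f)$ and $(H,x)\in(g\rightarrow f)(u)$ iff $(H\circ g)(x)\subseteq f(u)$ (where $x\in\mathrm{dom}(H\circ g)$). $\mathcal A(\mathbb N)$ is the space of subsets of $\mathbb N$ where a name of $A$ is an enumeration of the complement $\mathbb N\setminus A$ (negative information); $\mathcal O(\mathbb N)$ is the space of subsets of $\mathbb N$ where a name of $U$ is an enumeration of $U$ (enumerations may also list nothing at a given stage, so the empty set is covered). $\mathsf C_{\mathbb N}:\subseteq\mathcal A(\mathbb N)\rightrightarrows\mathbb N$, $A\mapsto A$, is defined for all nonempty $A$. $\lim:\subseteq\mathbb N^{\mathbb N}\to\mathbb N^{\mathbb N}$ is $\lim(p)(n)=\lim_{i\to\infty}p(\langle n,i\rangle)$, defined when all these limits exist. $\mathsf{Almost\mbox{ - }EC}:\mathcal A(\mathbb N)\rightrightarrows\mathcal O(\mathbb N)$ is defined by $U\in\mathsf{Almost\mbox{ - }EC}(A)$ iff $(A\setminus U)\cup(U\setminus A)$ is finite. -}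

module Defs where

open import Axiom.ExcludedMiddle using (ExcludedMiddle)
open import Data.Empty using (⊥-elim)
open import Data.Fin using (Fin)
open import Data.List using (List)
open import Data.List.Membership.Propositional using () renaming (_∈_ to _∈ˡ_)
open import Data.Nat using (ℕ; zero; suc; _+_; _≤_; _<_)
open import Data.Nat.Properties
  using (suc-injective; 0≢1+n; <-cmp)
open import Data.Product using (Σ-syntax; ∃-syntax; _×_; _,_; proj₁; proj₂)
open import Data.Product.Relation.Binary.Pointwise.NonDependent using (×-setoid)
open import Data.Sum using (inj₁; inj₂)
open import Data.Unit using (⊤)
open import Data.Vec using (Vec; []; _∷_; lookup)
open import Function using (_⇔_; mk⇔; module Equivalence; _∘_)
open import Level using (Level; 0ℓ) renaming (_⊔_ to _⊔ˡ_; suc to lsuc)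
open import Relation.Binary using (Setoid; tri<; tri≈; tri>)
open import Relation.Binary.PropositionalEquality
  using (_≡_; refl; sym; trans; cong₂; subst; _→-setoid_; setoid)
open import Relation.Nullary using (¬_; Dec; yes; no)
open import Relation.Unary using (Pred; _∈_; _∉_; _∪_; _∖_)
open import Relation.Unary.Relation.Binary.Equality using (≐-setoid)

open Setoid using (Carrier)
open Equivalence using (to; from)

private
  variable
    a b c d : Level
    n m : ℕ

1ℓ : Level
1ℓ = lsuc 0ℓ

-- A multi-valued partial function is its graph; x belongs to the domain
-- exactly when the set of values at x is nonempty.
record _⇉_ (X : Setoid a 0ℓ) (Y : Setoid b 0ℓ) : Set (a ⊔ˡ b ⊔ˡ 1ℓ) where
  private
    module X = Setoid X
    module Y = Setoid Y
  field
    rel  : X.Carrier → Y.Carrier → Set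
    resp : ∀ {x x′ y y′} → x X.≈ x′ → y Y.≈ y′ → rel x y → rel x′ y′

open _⇉_ public

dom : {X : Setoid a 0ℓ} {Y : Setoid b 0ℓ} → X ⇉ Y → Pred (Carrier X) b
dom f x = ∃[ y ] rel f x y

-- The intermediate and the target set are small, so that the condition
-- g(x) ⊆ dom(f) is again a small proposition.
_⊙_ : {X : Setoid a 0ℓ} {Y Z : Setoid 0ℓ 0ℓ} → Y ⇉ Z → X ⇉ Y → X ⇉ Z
rel  (f ⊙ g) x z = (∀ y → rel g x y → y ∈ dom f) × (∃[ y ] rel g x y × rel f y z)
resp (_⊙_ {X = X} {Y} {Z} f g) x≈x′ z≈z′ (g⊆ , y , gxy , fyz) =
  (λ y′ gx′y′ → g⊆ y′ (resp g (Setoid.sym X x≈x′) (Setoid.refl Y) gx′y′)) ,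
  y , resp g x≈x′ (Setoid.refl Y) gxy , resp f (Setoid.refl Y) z≈z′ fyz

_⁻¹ : {X : Setoid a 0ℓ} {Y : Setoid b 0ℓ} → X ⇉ Y → Y ⇉ X
rel  (f ⁻¹) y x = rel f x y
resp (f ⁻¹) y≈y′ x≈x′ = resp f x≈x′ y≈y′

⇉-setoid : Setoid 0ℓ 0ℓ → Setoid 0ℓ 0ℓ → Setoid 1ℓ 0ℓ
⇉-setoid X Y = record
  { Carrier       = X ⇉ Y
  ; _≈_           = λ f g → ∀ x y → rel f x y ⇔ rel g x y
  ; isEquivalence = record
    { refl  = λ x y → mk⇔ (λ r → r) (λ r → r)
    ; sym   = λ e x y → mk⇔ (from (e x y)) (to (e x y))
    ; trans = λ e e′ x y → mk⇔ (to (e′ x y) ∘ to (e x y)) (from (e x y) ∘ from (e′ x y))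
    }
  }

record _⇀_ (X : Setoid a 0ℓ) (Y : Setoid b 0ℓ) : Set (a ⊔ˡ b ⊔ˡ 1ℓ) where
  field
    graph      : X ⇉ Y
    functional : ∀ {x y y′} → rel graph x y → rel graph x y′ → Setoid._≈_ Y y y′

open _⇀_ public

_∘ₚ_ : {X Y Z : Setoid 0ℓ 0ℓ} → Y ⇀ Z → X ⇀ Y → X ⇀ Z
graph (f ∘ₚ g) = graph f ⊙ graph g
functional (_∘ₚ_ {Y = Y} {Z} f g) (_ , y , gxy , fyz) (_ , y′ , gxy′ , fy′z′) =
  functional f (resp (graph f) (functional g gxy gxy′) (Setoid.refl Z) fyz) fy′z′

Baire : Set
Baire = ℕ → ℕ

𝔹 : Setoid 0ℓ 0ℓ
𝔹 = ℕ →-setoid ℕ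

infix 4 _≗_
_≗_ : Baire → Baire → Set
_≗_ = Setoid._≈_ 𝔹

-- ⟪ p , q ⟫ = p 0, q 0, p 1, q 1, …
⟪_,_⟫ : Baire → Baire → Baire
⟪ p , q ⟫ zero    = p zero
⟪ p , q ⟫ (suc n) = ⟪ q , p ∘ suc ⟫ n

⟪⟫-cong : ∀ {p p′ q q′} → p ≗ p′ → q ≗ q′ → ⟪ p , q ⟫ ≗ ⟪ p′ , q′ ⟫
⟪⟫-cong p≗ q≗ zero    = p≗ zero
⟪⟫-cong p≗ q≗ (suc n) = ⟪⟫-cong q≗ (p≗ ∘ suc) n

⟪⟫-injective : ∀ {p p′ q q′} → ⟪ p , q ⟫ ≗ ⟪ p′ , q′ ⟫ → p ≗ p′ × q ≗ q′
⟪⟫-injective e = (λ n → left n e) , (λ n → left n (e ∘ suc))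
  where
  left : ∀ {p p′ q q′} n → ⟪ p , q ⟫ ≗ ⟪ p′ , q′ ⟫ → p n ≡ p′ n
  left zero    e = e zero
  left (suc n) e = left n (λ k → e (suc (suc k)))

⟪id,_⟫ : 𝔹 ⇀ 𝔹 → 𝔹 ⇀ 𝔹
rel  (graph ⟪id, F ⟫) p r = ∃[ q ] rel (graph F) p q × r ≗ ⟪ p , q ⟫
resp (graph ⟪id, F ⟫) p≗p′ r≗r′ (q , Fpq , r≗) =
  q , resp (graph F) p≗p′ (λ _ → refl) Fpq ,
  λ n → trans (sym (r≗r′ n)) (trans (r≗ n) (⟪⟫-cong p≗p′ (λ _ → refl) n))
functional ⟪id, F ⟫ (q , Fpq , r≗) (q′ , Fpq′ , r′≗) n =
  trans (r≗ n) (trans (⟪⟫-cong (λ _ → refl) (functional F Fpq Fpq′) n) (sym (r′≗ n)))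

triangle : ℕ → ℕ
triangle zero    = zero
triangle (suc n) = suc n + triangle n

-- Cantor's bijection ℕ × ℕ → ℕ.
⟨_,_⟩ : ℕ → ℕ → ℕ
⟨ n , k ⟩ = triangle (n + k) + k

-- Computability is given by Kleene's μ-recursive functions relative to an oracle.
-- A machine reads its infinite input through the oracle and, given n,
-- returns the n-th symbol of its output.
data Prog : ℕ → Set where
  zero   : Prog n
  succ   : Prog 1
  proj   : Fin n → Prog n
  oracle : Prog 1
  comp   : Prog m → Vec (Prog n) m → Prog n
  prec   : Prog n → Prog (suc (suc n)) → Prog (suc n)
  mu     : Prog (suc n) → Prog n

mutual
  data Eval (p : Baire) : Prog n → Vec ℕ n → ℕ → Set where
    zero   : {xs : Vec ℕ n} → Eval p zero xs 0
    succ   : ∀ {x} → Eval p succ (x ∷ []) (suc x)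
    proj   : {xs : Vec ℕ n} (i : Fin n) → Eval p (proj i) xs (lookup xs i)
    oracle : ∀ {x} → Eval p oracle (x ∷ []) (p x)
    comp   : {f : Prog m} {gs : Vec (Prog n) m} {xs : Vec ℕ n} {ys : Vec ℕ m} {z : ℕ} →
             Evals p gs xs ys → Eval p f ys z → Eval p (comp f gs) xs z
    prec0  : {f : Prog n} {g : Prog (suc (suc n))} {xs : Vec ℕ n} {y : ℕ} →
             Eval p f xs y → Eval p (prec f g) (0 ∷ xs) y
    precS  : {f : Prog n} {g : Prog (suc (suc n))} {xs : Vec ℕ n} {k y z : ℕ} →
             Eval p (prec f g) (k ∷ xs) y → Eval p g (k ∷ y ∷ xs) z →
             Eval p (prec f g) (suc k ∷ xs) z
    mu     : {f : Prog (suc n)} {xs : Vec ℕ n} {y : ℕ} →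
             (∀ i → i < y → ∃[ k ] Eval p f (i ∷ xs) (suc k)) →
             Eval p f (y ∷ xs) 0 → Eval p (mu f) xs y

  data Evals (p : Baire) : Vec (Prog n) m → Vec ℕ n → Vec ℕ m → Set where
    []  : {xs : Vec ℕ n} → Evals p [] xs []
    _∷_ : {g : Prog n} {gs : Vec (Prog n) m} {xs : Vec ℕ n} {y : ℕ} {ys : Vec ℕ m} →
          Eval p g xs y → Evals p gs xs ys → Evals p (g ∷ gs) xs (y ∷ ys)

mutual
  Eval-resp : ∀ {p p′} {e : Prog n} {xs y} → p ≗ p′ → Eval p e xs y → Eval p′ e xs y
  Eval-resp p≗ zero        = zero
  Eval-resp p≗ succ        = succ
  Eval-resp p≗ (proj i)    = proj i
  Eval-resp {p′ = p′} p≗ (oracle {x}) =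
    subst (Eval p′ oracle (x ∷ [])) (sym (p≗ x)) oracle
  Eval-resp p≗ (comp ds d) = comp (Evals-resp p≗ ds) (Eval-resp p≗ d)
  Eval-resp p≗ (prec0 d)   = prec0 (Eval-resp p≗ d)
  Eval-resp p≗ (precS d e) = precS (Eval-resp p≗ d) (Eval-resp p≗ e)
  Eval-resp p≗ (mu h d)    =
    mu (λ i i<y → proj₁ (h i i<y) , Eval-resp p≗ (proj₂ (h i i<y))) (Eval-resp p≗ d)

  Evals-resp : ∀ {p p′} {gs : Vec (Prog n) m} {xs ys} →
               p ≗ p′ → Evals p gs xs ys → Evals p′ gs xs ys
  Evals-resp p≗ []       = []
  Evals-resp p≗ (d ∷ ds) = Eval-resp p≗ d ∷ Evals-resp p≗ ds

mutual
  Eval-det : ∀ {p} {e : Prog n} {xs y y′} → Eval p e xs y → Eval p e xs y′ → y ≡ y′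
  Eval-det zero zero               = refl
  Eval-det succ succ               = refl
  Eval-det (proj i) (proj .i)      = refl
  Eval-det oracle oracle           = refl
  Eval-det (comp ds d) (comp es e) with refl ← Evals-det ds es = Eval-det d e
  Eval-det (prec0 d) (prec0 e)     = Eval-det d e
  Eval-det (precS d e) (precS d′ e′) with refl ← Eval-det d d′ = Eval-det e e′
  Eval-det (mu {y = y} h d) (mu {y = y′} h′ d′) with <-cmp y y′
  ... | tri< y<y′ _ _ = ⊥-elim (0≢1+n (Eval-det d (proj₂ (h′ y y<y′))))
  ... | tri≈ _ y≡y′ _ = y≡y′
  ... | tri> _ _ y′<y = ⊥-elim (0≢1+n (sym (Eval-det (proj₂ (h y′ y′<y)) d′)))

  Evals-det : ∀ {p} {gs : Vec (Prog n) m} {xs ys ys′} →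
              Evals p gs xs ys → Evals p gs xs ys′ → ys ≡ ys′
  Evals-det [] []             = refl
  Evals-det (d ∷ ds) (e ∷ es) = cong₂ _∷_ (Eval-det d e) (Evals-det ds es)

Machine : Set
Machine = Prog 1

-- Defined at p exactly when the whole infinite output is produced.
⟦_⟧ : Machine → 𝔹 ⇀ 𝔹
rel  (graph ⟦ M ⟧) p r = ∀ n → Eval p M (n ∷ []) (r n)
resp (graph ⟦ M ⟧) {p} {p′} p≗p′ r≗r′ h n =
  subst (Eval p′ M (n ∷ [])) (r≗r′ n) (Eval-resp p≗p′ (h n))
functional ⟦ M ⟧ h h′ n = Eval-det (h n) (h′ n)

-- Outside dom(F) the machine may behave arbitrarily.
Computable : 𝔹 ⇀ 𝔹 → Set
Computable F = ∃[ M ] ∀ p r → rel (graph F) p r → rel (graph ⟦ M ⟧) p r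

Φ : Machine → Baire → 𝔹 ⇀ 𝔹
rel  (graph (Φ U p)) q r = rel (graph ⟦ U ⟧) ⟪ p , q ⟫ r
resp (graph (Φ U p)) q≗q′ = resp (graph ⟦ U ⟧) (⟪⟫-cong (λ _ → refl) q≗q′)
functional (Φ U p) = functional ⟦ U ⟧

-- U simulates every machine M, including M's dependence on a parameter p
-- in its input: the first input s of U is a description of "M with p",
-- obtained computably from p.  (The utm and smn properties of Φ.)
Universal : Machine → Set
Universal U = ∀ M → ∃[ S ]
  ((∀ p → p ∈ dom (graph ⟦ S ⟧)) ×
   (∀ p s → rel (graph ⟦ S ⟧) p s →
    ∀ q r → rel (graph (Φ U s)) q r ⇔ rel (graph ⟦ M ⟧) ⟪ p , q ⟫ r))

record RepSpace (c : Level) : Set (lsuc c ⊔ˡ 1ℓ) where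
  field
    set        : Setoid c 0ℓ
    δ          : 𝔹 ⇀ set
    surjective : ∀ x → ∃[ p ] rel (graph δ) p x

open RepSpace public

δcyl : (X : RepSpace c) → 𝔹 ⇀ set X
rel  (graph (δcyl X)) r x = ∃[ p ] ∃[ q ] r ≗ ⟪ p , q ⟫ × rel (graph (δ X)) p x
resp (graph (δcyl X)) r≗r′ x≈x′ (p , q , r≗ , px) =
  p , q , (λ n → trans (sym (r≗r′ n)) (r≗ n)) , resp (graph (δ X)) (λ _ → refl) x≈x′ px
functional (δcyl X) (p , q , r≗ , px) (p′ , q′ , r≗′ , p′x′) =
  functional (δ X)
    (resp (graph (δ X)) (proj₁ (⟪⟫-injective (λ n → trans (sym (r≗ n)) (r≗′ n))))
      (Setoid.refl (set X)) px)
    p′x′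

BaireSpace : RepSpace 0ℓ
set BaireSpace = 𝔹
rel  (graph (δ BaireSpace)) p x = p ≗ x
resp (graph (δ BaireSpace)) p≗p′ x≗x′ h n = trans (sym (p≗p′ n)) (trans (h n) (x≗x′ n))
functional (δ BaireSpace) h h′ n = trans (sym (h n)) (h′ n)
surjective BaireSpace x = x , λ _ → refl

ℕSpace : RepSpace 0ℓ
set ℕSpace = setoid ℕ
rel  (graph (δ ℕSpace)) p n = p 0 ≡ n
resp (graph (δ ℕSpace)) p≗p′ refl h = trans (sym (p≗p′ 0)) h
functional (δ ℕSpace) h h′ = trans (sym h) h′
surjective ℕSpace n = (λ _ → n) , refl

_×ʳ_ : RepSpace c → RepSpace d → RepSpace (c ⊔ˡ d)
set (X ×ʳ Y) = ×-setoid (set X) (set Y)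
rel  (graph (δ (X ×ʳ Y))) r (x , y) =
  ∃[ p ] ∃[ q ] r ≗ ⟪ p , q ⟫ × rel (graph (δ X)) p x × rel (graph (δ Y)) q y
resp (graph (δ (X ×ʳ Y))) r≗r′ (x≈ , y≈) (p , q , r≗ , px , qy) =
  p , q , (λ n → trans (sym (r≗r′ n)) (r≗ n)) ,
  resp (graph (δ X)) (λ _ → refl) x≈ px , resp (graph (δ Y)) (λ _ → refl) y≈ qy
functional (δ (X ×ʳ Y)) (p , q , r≗ , px , qy) (p′ , q′ , r≗′ , p′x′ , q′y′) =
  let p≗ , q≗ = ⟪⟫-injective (λ n → trans (sym (r≗ n)) (r≗′ n)) in
  functional (δ X) (resp (graph (δ X)) p≗ (Setoid.refl (set X)) px) p′x′ ,
  functional (δ Y) (resp (graph (δ Y)) q≗ (Setoid.refl (set Y)) qy) q′y′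
surjective (X ×ʳ Y) (x , y) =
  let p , px = surjective X x
      q , qy = surjective Y y
  in ⟪ p , q ⟫ , p , q , (λ _ → refl) , px , qy

-- p lists n at stage i if p i = n + 1; if p i = 0, nothing is listed.
_lists_ : Baire → Pred ℕ 0ℓ
p lists n = ∃[ i ] p i ≡ suc n

-- Excluded middle is needed for every set of numbers to have a name, and
-- for a set to be determined by its complement.
module _ (em : ExcludedMiddle 0ℓ) where

  private
    lists-resp : ∀ {p p′ n} → p ≗ p′ → p lists n → p′ lists n
    lists-resp p≗ (i , e) = i , trans (sym (p≗ i)) e

    enumerate : (A : Pred ℕ 0ℓ) → ∃[ p ] ∀ n → (p lists n) ⇔ (n ∈ A)
    enumerate A = p , λ n → mk⇔ (λ (i , e) → sound i (em {A i}) e) (λ An → n , complete n (em {A n}) An)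
      where
      code : (i : ℕ) → Dec (A i) → ℕ
      code i (yes _) = suc i
      code i (no _)  = 0
      p : Baire
      p i = code i em
      sound : ∀ i {n} (d : Dec (A i)) → code i d ≡ suc n → A n
      sound i (yes Ai) e = subst A (suc-injective e) Ai
      sound i (no _)   ()
      complete : ∀ n (d : Dec (A n)) → A n → code n d ≡ suc n
      complete n (yes _)  _  = refl
      complete n (no ¬An) An = ⊥-elim (¬An An)

    stable : ∀ {A : Pred ℕ 0ℓ} {n} → ¬ (n ∉ A) → n ∈ A
    stable {A} {n} ¬¬An with em {A n}
    ... | yes An = An
    ... | no ¬An = ⊥-elim (¬¬An ¬An)

  𝒪ℕ : RepSpace 1ℓ
  set 𝒪ℕ = ≐-setoid ℕ 0ℓ
  rel  (graph (δ 𝒪ℕ)) p A = ∀ n → (p lists n) ⇔ (n ∈ A)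
  resp (graph (δ 𝒪ℕ)) p≗p′ (A⊆ , ⊆A) h n =
    mk⇔ (λ l → A⊆ (to (h n) (lists-resp (λ i → sym (p≗p′ i)) l)))
        (λ An → lists-resp p≗p′ (from (h n) (⊆A An)))
  functional (δ 𝒪ℕ) h h′ =
    (λ {n} An → to (h′ n) (from (h n) An)) , (λ {n} An → to (h n) (from (h′ n) An))
  surjective 𝒪ℕ A = enumerate A

  𝒜ℕ : RepSpace 1ℓ
  set 𝒜ℕ = ≐-setoid ℕ 0ℓ
  rel  (graph (δ 𝒜ℕ)) p A = ∀ n → (p lists n) ⇔ (n ∉ A)
  resp (graph (δ 𝒜ℕ)) p≗p′ (A⊆ , ⊆A) h n =
    mk⇔ (λ l An → to (h n) (lists-resp (λ i → sym (p≗p′ i)) l) (⊆A An))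
        (λ ¬An → lists-resp p≗p′ (from (h n) (λ An → ¬An (A⊆ An))))
  functional (δ 𝒜ℕ) {y = A} {A′} h h′ =
    (λ {n} An → stable {A′} (λ ¬A′n → to (h n) (from (h′ n) ¬A′n) An)) ,
    (λ {n} A′n → stable {A} (λ ¬An → to (h′ n) (from (h n) ¬An) A′n))
  surjective 𝒜ℕ A = enumerate (λ n → n ∉ A)

Φ[_,_] : (X Y : RepSpace 0ℓ) → Machine → Baire → set X ⇉ set Y
Φ[ X , Y ] U p = graph (δ Y) ⊙ (graph (Φ U p) ⊙ (graph (δcyl X) ⁻¹))

ℳ : Machine → RepSpace 0ℓ → RepSpace 0ℓ → RepSpace 1ℓ
set (ℳ U X Y) = record
  { Carrier       = Σ[ H ∈ set X ⇉ set Y ] ∃[ p ] Φ[ X , Y ] U p ≈ H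
  ; _≈_           = λ (H , _) (H′ , _) → H ≈ H′
  ; isEquivalence = record
    { refl  = λ { {H , _} → refl≈ {H} }
    ; sym   = λ { {H , _} {H′ , _} → sym≈ {H} {H′} }
    ; trans = λ { {H , _} {H′ , _} {H″ , _} → trans≈ {H} {H′} {H″} }
    }
  }
  where open Setoid (⇉-setoid (set X) (set Y)) using (_≈_)
          renaming (refl to refl≈; sym to sym≈; trans to trans≈)
rel (graph (δ (ℳ U X Y))) p (H , _) = Φ[ X , Y ] U p ≈ H
  where open Setoid (⇉-setoid (set X) (set Y)) using (_≈_)
resp (graph (δ (ℳ U X Y))) {p} {p′} p≗p′ H≈H′ h x y =
  mk⇔ (λ r → to (H≈H′ x y) (to (h x y) (transport p′ p (λ n → sym (p≗p′ n)) r)))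
      (λ r → transport p p′ p≗p′ (from (h x y) (from (H≈H′ x y) r)))
  where
  Φ-resp : ∀ p p′ → p ≗ p′ → ∀ {q r} → rel (graph (Φ U p)) q r → rel (graph (Φ U p′)) q r
  Φ-resp p p′ p≗p′ = resp (graph ⟦ U ⟧) (⟪⟫-cong p≗p′ (λ _ → refl)) (λ _ → refl)
  transport : ∀ p p′ → p ≗ p′ → ∀ {x y} → rel (Φ[ X , Y ] U p) x y → rel (Φ[ X , Y ] U p′) x y
  transport p p′ p≗p′ (⊆δ , r , (⊆Φ , q , xq , qr) , ry) =
    (λ { r′ (_ , q′ , xq′ , q′r′) →
         ⊆δ r′ (⊆Φ , q′ , xq′ , Φ-resp p′ p (λ n → sym (p≗p′ n)) q′r′) }) ,
    r ,
    ((λ q′ xq′ → let r′ , q′r′ = ⊆Φ q′ xq′ in r′ , Φ-resp p p′ p≗p′ q′r′) ,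
     q , xq , Φ-resp p p′ p≗p′ qr) ,
    ry
functional (δ (ℳ U X Y)) {y = H , _} {H′ , _} h h′ x y =
  mk⇔ (to (h′ x y) ∘ from (h x y)) (to (h x y) ∘ from (h′ x y))
surjective (ℳ U X Y) (H , p , h) = p , h

record Problem (c d : Level) : Set (lsuc (c ⊔ˡ d) ⊔ˡ 1ℓ) where
  constructor problem
  field
    source : RepSpace c
    target : RepSpace d
    fun    : set source ⇉ set target

open Problem public

infix 4 _⊢_ _≤W_ _≡W_

_⊢_ : 𝔹 ⇀ 𝔹 → Problem c d → Set (c ⊔ˡ d)
F ⊢ problem X Y f = ∀ p x → rel (graph (δ X)) p x → x ∈ dom f →
  ∃[ q ] rel (graph F) p q × (∃[ y ] rel (graph (δ Y)) q y × rel f x y)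

_≤W_ : ∀ {c d c′ d′} → Problem c d → Problem c′ d′ → Set (c ⊔ˡ d ⊔ˡ c′ ⊔ˡ d′ ⊔ˡ 1ℓ)
f ≤W g = ∃[ K ] ∃[ H ] Computable K × Computable H ×
  (∀ G → G ⊢ g → (K ∘ₚ ⟪id, G ∘ₚ H ⟫) ⊢ f)

_≡W_ : ∀ {c d c′ d′} → Problem c d → Problem c′ d′ → Set (c ⊔ˡ d ⊔ˡ c′ ⊔ˡ d′ ⊔ˡ 1ℓ)
f ≡W g = f ≤W g × g ≤W f

-- (g → f), for g with nonempty domain.  For universal U its domain is all of
-- dom(f): a constant H with value in f(u) has a name.
implication : Machine → (g : Problem c 0ℓ) → ∃[ x ] x ∈ dom (fun g) →
              Problem d 0ℓ → Problem d (c ⊔ˡ 1ℓ)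
implication U (problem X Y g) _ (problem A V f) = problem A (ℳ U Y V ×ʳ X) (record
  { rel  = λ u ((H , _) , x) →
      u ∈ dom f × x ∈ dom (H ⊙ g) × (∀ v → rel (H ⊙ g) x v → rel f u v)
  ; resp = λ { {u} {u′} {(H , _) , x} {(H′ , _) , x′} u≈u′ (H≈H′ , x≈x′)
               ((w , fuw) , (v , Hgxv) , Hg⊆f) →
      (w , resp f u≈u′ V.refl fuw) ,
      (v , change {H} {H′} H≈H′ (resp (H ⊙ g) x≈x′ V.refl Hgxv)) ,
      (λ v′ Hgx′v′ → resp f u≈u′ V.refl (Hg⊆f v′
        (resp (H ⊙ g) (X.sym x≈x′) V.refl
          (change {H′} {H} (sym≈ {H} {H′} H≈H′) Hgx′v′)))) }
  })
  where
  module X = Setoid (set X)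
  module V = Setoid (set V)
  open Setoid (⇉-setoid (set Y) (set V)) using (_≈_) renaming (sym to sym≈)
  change : ∀ {H H′} → H ≈ H′ → ∀ {x v} → rel (H ⊙ g) x v → rel (H′ ⊙ g) x v
  change H≈H′ {v = v} (g⊆ , y , gxy , Hyv) =
    (λ y′ gxy′ → let v′ , Hy′v′ = g⊆ y′ gxy′ in v′ , to (H≈H′ y′ v′) Hy′v′) ,
    y , gxy , to (H≈H′ y v) Hyv

Lim : Problem 0ℓ 0ℓ
Lim = problem BaireSpace BaireSpace (record
  { rel  = λ p r → ∀ n → ∃[ k ] ∀ i → k ≤ i → p ⟨ n , i ⟩ ≡ r n
  ; resp = λ p≗p′ r≗r′ h n → let k , e = h n in
      k , λ i k≤i → trans (sym (p≗p′ ⟨ n , i ⟩)) (trans (e i k≤i) (r≗r′ n))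
  })

Finite : Pred (Pred ℕ 0ℓ) 0ℓ
Finite A = ∃[ ns ] ∀ n → n ∈ A → n ∈ˡ ns

module _ (em : ExcludedMiddle 0ℓ) where

  Cℕ : Problem 1ℓ 0ℓ
  Cℕ = problem (𝒜ℕ em) ℕSpace (record
    { rel  = λ A n → n ∈ A
    ; resp = λ { (A⊆ , _) refl An → A⊆ An }
    })

  Cℕ-dom-nonempty : ∃[ A ] A ∈ dom (fun Cℕ)
  Cℕ-dom-nonempty = (λ _ → ⊤) , 0 , _

  AlmostEC : Problem 1ℓ 1ℓ
  AlmostEC = problem (𝒜ℕ em) (𝒪ℕ em) (record
    { rel  = λ A U → Finite ((A ∖ U) ∪ (U ∖ A))
    ; resp = λ { (A⊆ , ⊆A) (U⊆ , ⊆U) (ns , h) → ns , λ n →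
        λ { (inj₁ (A′n , ¬U′n)) → h n (inj₁ (⊆A A′n , ¬U′n ∘ U⊆))
          ; (inj₂ (U′n , ¬A′n)) → h n (inj₂ (⊆U U′n , ¬A′n ∘ A⊆)) } }
    })

{-# OPTIONS --safe #-}
module Submission where

-- Almost-EC reduces to the implication: from an enumeration p of the
-- complement of A, the double sequence u(n,i) = 1 as long as n has not been
-- listed by stage i, and 0 afterwards, converges to the characteristic
-- function of A.  A solution of the implication at u is a pair (H , B) where B
-- is nonempty and H maps each y in B to this characteristic function.  Let
-- y(s) be the least number not listed as outside B by stage s; y(s) is
-- eventually equal to min B.  For each n search for a stage s at least n at
-- which H(y(s))(n) has been computed within s steps, and list n if the value
-- found is 1.  The search always ends, because H(min B) is total, and for all
-- large n only stages with y(s) = min B are considered, so only finitely many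
-- answers are wrong (listing-eventually, eventually-decides).  "Within s
-- steps" is provided by a total approximation of the universal machine,
-- constructed by recursion on programs (sound, complete).
--
-- The implication reduces to Almost-EC: given convergent u, let A be the set
-- of codes of pairs (n , k) such that u(n,k+j) = u(n,k) for all j.  Its
-- complement is enumerable from u.  Let V differ from A by a finite set, and
-- let B be the set of all y such that every m in V with m at least y is in A.
-- Then B is nonempty, its complement is enumerable from u and an enumeration
-- of V, and lim u is computable from these data and any y in B: for given n,
-- search V for a code (n , k) that is at least y, and return u(n,k).  The
-- search ends since (n , k) is in both A and V for all large k, and the result
-- is correct by the choice of B (evaluates).  The utm and smn properties turn
-- this computation into an element of the function space (solution).

open import Axiom.ExcludedMiddle using (ExcludedMiddle)
open import Data.Empty using (⊥-elim)
open import Data.Fin using (Fin; zero; suc; _↑ʳ_)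
open import Data.Nat hiding (parity)
open import Data.Nat.Properties
open import Data.List using (List; []; _∷_; upTo)
open import Data.List.Membership.Propositional using () renaming (_∈_ to _∈ˡ_)
open import Data.List.Membership.Propositional.Properties using (∈-upTo⁺)
open import Data.List.Relation.Unary.Any using (here; there)
open import Data.Product using (∃-syntax; _×_; _,_; proj₁; proj₂)
open import Data.Sum using (_⊎_; inj₁; inj₂)
open import Data.Unit using (⊤)
open import Data.Vec using (Vec; []; _∷_; _++_; drop; tabulate; lookup)
open import Data.Vec.Properties using (tabulate∘lookup)
open import Function using (_∘_; const; id; _⇔_; mk⇔; module Equivalence)
open import Level using (0ℓ)
open import Relation.Binary using (Setoid; tri<; tri≈; tri>)
open import Relation.Binary.PropositionalEquality
  using (_≡_; _≢_; refl; sym; trans; cong; cong₂; subst)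
open import Relation.Nullary using (¬_; yes; no)
open import Relation.Nullary.Decidable using (decidable-stable)
open import Relation.Unary using (Pred; _∈_; _∉_)
open import Defs

private
  variable
    n m k : ℕ

-- Total functions computable relative to an oracle

-- A total function of an oracle and n numbers, with a program for it.  Programs
-- are assembled by operations on Total, marked by the subscript ₜ, that are
-- arranged so that fun reduces to the intended function by computation.
record Total (n : ℕ) : Set where
  field
    fun     : Baire → Vec ℕ n → ℕ
    prog    : Prog n
    correct : ∀ p xs → Eval p prog xs (fun p xs)

open Total
open Equivalence using (to; from)

values : Vec (Total n) m → Baire → Vec ℕ n → Vec ℕ m
values []       p xs = []
values (g ∷ gs) p xs = fun g p xs ∷ values gs p xs

progs : Vec (Total n) m → Vec (Prog n) m
progs []       = []
progs (g ∷ gs) = prog g ∷ progs gs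

corrects : (gs : Vec (Total n) m) → ∀ p xs → Evals p (progs gs) xs (values gs p xs)
corrects []       p xs = []
corrects (g ∷ gs) p xs = correct g p xs ∷ corrects gs p xs

call : Total m → Vec (Total n) m → Total n
fun     (call f gs) p xs = fun f p (values gs p xs)
prog    (call f gs)      = comp (prog f) (progs gs)
correct (call f gs) p xs = comp (corrects gs p xs) (correct f p _)

-- The program of F, with an extensionally equal description of its function.
as : (F : Total n) (f : Baire → Vec ℕ n → ℕ) → (∀ p xs → fun F p xs ≡ f p xs) → Total n
fun     (as F f e)      = f
prog    (as F f e)      = prog F
correct (as F f e) p xs = subst (Eval p (prog F) xs) (e p xs) (correct F p xs)

var : Fin n → Total n
fun     (var i) p xs = lookup xs i
prog    (var i)      = proj i
correct (var i) p xs = proj i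

v0 : Total (1 + n)
v0 = var zero
v1 : Total (2 + n)
v1 = var (suc zero)
v2 : Total (3 + n)
v2 = var (suc (suc zero))
v3 : Total (4 + n)
v3 = var (suc (suc (suc zero)))

oracleₜ : Total 1
fun     oracleₜ p (x ∷ []) = p x
prog    oracleₜ            = oracle
correct oracleₜ p (x ∷ []) = oracle

succₜ : Total 1
fun     succₜ p (x ∷ []) = suc x
prog    succₜ            = succ
correct succₜ p (x ∷ []) = succ

zeroₜ : Total n
fun     zeroₜ p xs = 0
prog    zeroₜ      = zero
correct zeroₜ p xs = zero

iter : ℕ → (ℕ → ℕ → ℕ) → ℕ → ℕ
iter a f zero    = a
iter a f (suc k) = f k (iter a f k)

primrec : Total n → Total (2 + n) → Total (1 + n)
fun (primrec F G) p (k ∷ xs) = iter (fun F p xs) (λ i y → fun G p (i ∷ y ∷ xs)) k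
prog (primrec F G) = prec (prog F) (prog G)
correct (primrec F G) p (k ∷ xs) = go k
  where
  go : ∀ k → Eval p (prec (prog F) (prog G)) (k ∷ xs) (fun (primrec F G) p (k ∷ xs))
  go zero    = prec0 (correct F p xs)
  go (suc k) = precS (go k) (correct G p _)

-- All variables except the first d.
later : ∀ d → Vec (Total (d + n)) n
later d = tabulate (λ i → var (d ↑ʳ i))

values-plug : ∀ d (us : Vec (Total (d + n)) k) p xs →
              values (us ++ later d) p xs ≡ values us p xs ++ drop d xs
values-plug d (u ∷ us) p xs = cong (fun u p xs ∷_) (values-plug d us p xs)
values-plug d []       p xs = trans (values-tabulate (d ↑ʳ_)) (go d xs)
  where
  values-tabulate : ∀ {n m} {xs : Vec ℕ m} (ρ : Fin n → Fin m) →
    values (tabulate (λ i → var (ρ i))) p xs ≡ tabulate (λ i → lookup xs (ρ i))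
  values-tabulate {zero}          ρ = refl
  values-tabulate {suc n} {xs = xs} ρ = cong (lookup xs (ρ zero) ∷_) (values-tabulate (ρ ∘ suc))
  go : ∀ {n} d (xs : Vec ℕ (d + n)) → tabulate (λ i → lookup xs (d ↑ʳ i)) ≡ drop d xs
  go zero    xs       = tabulate∘lookup xs
  go (suc d) (x ∷ xs) = go d xs

-- F with its first k arguments given by us; the remaining arguments are the
-- variables after the first d.
plug : ∀ d → Total (k + n) → Vec (Total (d + n)) k → Total (d + n)
plug d F us = as (call F (us ++ later d))
  (λ p xs → fun F p (values us p xs ++ drop d xs))
  (λ p xs → cong (fun F p) (values-plug d us p xs))

unary : (ℕ → ℕ) → Baire → Vec ℕ 1 → ℕ
unary f p (a ∷ []) = f a

binary : (ℕ → ℕ → ℕ) → Baire → Vec ℕ 2 → ℕ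
binary f p (a ∷ b ∷ []) = f a b

ternary : (ℕ → ℕ → ℕ → ℕ) → Baire → Vec ℕ 3 → ℕ
ternary f p (a ∷ b ∷ c ∷ []) = f a b c

sucₜ : Total n → Total n
sucₜ a = call succₜ (a ∷ [])

-- The value of the oracle.
ask : Total n → Total n
ask a = call oracleₜ (a ∷ [])

predₜ : Total n → Total n
predₜ a = call (as (primrec zeroₜ v0) (unary pred) (λ { p (zero ∷ []) → refl ; p (suc a ∷ []) → refl })) (a ∷ [])

-- ifz c a b is a if c is zero, and b otherwise; zero plays the part of truth
-- in all tests below.
ifz : ℕ → ℕ → ℕ → ℕ
ifz zero    a b = a
ifz (suc _) a b = b

ifzₜ : Total n → Total n → Total n → Total n
ifzₜ c a b = call (as (primrec v0 v3) (ternary ifz)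
  (λ { p (zero ∷ a ∷ b ∷ []) → refl ; p (suc c ∷ a ∷ b ∷ []) → refl })) (c ∷ a ∷ b ∷ [])

infixl 6 _+ₜ_ _∸ₜ_

_+ₜ_ : Total n → Total n → Total n
a +ₜ b = call (as (primrec v0 (sucₜ v1)) (binary _+_) (λ { p (a ∷ b ∷ []) → go p a b })) (a ∷ b ∷ [])
  where
  go : ∀ p a b → fun (primrec v0 (sucₜ v1)) p (a ∷ b ∷ []) ≡ a + b
  go p zero    b = refl
  go p (suc a) b = cong suc (go p a b)

_∸ₜ_ : Total n → Total n → Total n
a ∸ₜ b = call (as (call (primrec v0 (predₜ v1)) (v1 ∷ v0 ∷ [])) (binary _∸_)
                  (λ { p (a ∷ b ∷ []) → go p a b })) (a ∷ b ∷ [])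
  where
  go : ∀ p a b → fun (primrec v0 (predₜ v1)) p (b ∷ a ∷ []) ≡ a ∸ b
  go p a zero    = refl
  go p a (suc b) = trans (cong pred (go p a b)) (pred[m∸n]≡m∸[1+n] a b)

-- The test for equality.
distance : ℕ → ℕ → ℕ
distance a b = (a ∸ b) + (b ∸ a)

distanceₜ : Total n → Total n → Total n
distanceₜ a b = (a ∸ₜ b) +ₜ (b ∸ₜ a)

distance-0 : ∀ a → distance a a ≡ 0
distance-0 a = cong₂ _+_ (n∸n≡0 a) (n∸n≡0 a)

distance≡0⇒≡ : ∀ a b → distance a b ≡ 0 → a ≡ b
distance≡0⇒≡ a b e = ≤-antisym (m∸n≡0⇒m≤n (m+n≡0⇒m≡0 _ e)) (m∸n≡0⇒m≤n (m+n≡0⇒n≡0 (a ∸ b) e))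

triangleₜ : Total n → Total n
triangleₜ a = call (as (primrec zeroₜ (sucₜ v0 +ₜ v1)) (unary triangle)
  (λ { p (a ∷ []) → go p a })) (a ∷ [])
  where
  go : ∀ p a → fun (primrec zeroₜ (sucₜ v0 +ₜ v1)) p (a ∷ []) ≡ triangle a
  go p zero    = refl
  go p (suc a) = cong (suc a +_) (go p a)

pairₜ : Total n → Total n → Total n
pairₜ a b = triangleₜ (a +ₜ b) +ₜ b

-- Bounded search

-- The least zero of g below s, or s if there is none.
least : (ℕ → ℕ) → ℕ → ℕ
least g zero    = 0
least g (suc s) = ifz (g (least g s)) (least g s) (suc s)

least-stuck : ∀ g s → g (least g s) ≢ 0 → least g s ≡ s
least-stuck g zero    _  = refl
least-stuck g (suc s) ≢0 with g (least g s) in eq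
... | zero  = ⊥-elim (≢0 eq)
... | suc _ = refl

least-minimal : ∀ g s {i} → i < least g s → g i ≢ 0
least-minimal g (suc s) {i} i< gi≡0 with g (least g s) in eq
... | zero  = least-minimal g s i< gi≡0
... | suc _ with m≤n⇒m<n∨m≡n (≤-pred i<)
...   | inj₁ i<s  = least-minimal g s (subst (i <_) (sym stuck) i<s) gi≡0
  where stuck = least-stuck g s (λ e → 0≢1+n (trans (sym e) eq))
...   | inj₂ refl = 0≢1+n (trans (sym gi≡0) (trans (cong g (sym stuck)) eq))
  where stuck = least-stuck g s (λ e → 0≢1+n (trans (sym e) eq))

least-finds : ∀ g {s y} → g y ≡ 0 → (∀ {i} → i < y → g i ≢ 0) → y ≤ s → least g s ≡ y
least-finds g {s} {y} gy≡0 below y≤s with <-cmp (least g s) y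
... | tri< l<y _ _ = ⊥-elim (<⇒≱ (subst (_< y) (least-stuck g s (below l<y)) l<y) y≤s)
... | tri≈ _ l≡y _ = l≡y
... | tri> _ _ y<l = ⊥-elim (least-minimal g s y<l gy≡0)

leastₜ : Total (1 + n) → Total (1 + n)
leastₜ F = as (primrec zeroₜ (ifzₜ (plug 2 F (v1 ∷ [])) v1 (sucₜ v0)))
  (λ { p (s ∷ xs) → least (λ y → fun F p (y ∷ xs)) s }) (λ { p (s ∷ xs) → go p xs s })
  where
  go : ∀ p xs s → fun (primrec zeroₜ (ifzₜ (plug 2 F (v1 ∷ [])) v1 (sucₜ v0))) p (s ∷ xs)
                  ≡ least (λ y → fun F p (y ∷ xs)) s
  go p xs zero    = refl
  go p xs (suc s) rewrite go p xs s = refl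

-- 0 if g has a zero below s, and 1 otherwise.
noZero : (ℕ → ℕ) → ℕ → ℕ
noZero g zero    = 1
noZero g (suc s) = ifz (g s) 0 (noZero g s)

noZeroₜ : Total (1 + n) → Total (1 + n)
noZeroₜ F = as (primrec (sucₜ zeroₜ) (ifzₜ (plug 2 F (v0 ∷ [])) zeroₜ v1))
  (λ { p (s ∷ xs) → noZero (λ y → fun F p (y ∷ xs)) s }) (λ { p (s ∷ xs) → go p xs s })
  where
  go : ∀ p xs s → fun (primrec (sucₜ zeroₜ) (ifzₜ (plug 2 F (v0 ∷ [])) zeroₜ v1)) p (s ∷ xs)
                  ≡ noZero (λ y → fun F p (y ∷ xs)) s
  go p xs zero    = refl
  go p xs (suc s) rewrite go p xs s = refl

noZero-0 : ∀ g {s i} → i < s → g i ≡ 0 → noZero g s ≡ 0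
noZero-0 g {suc s} {i} i< gi≡0 with g s in eq
... | zero  = refl
... | suc _ with m≤n⇒m<n∨m≡n (≤-pred i<)
...   | inj₁ i<s  = noZero-0 g i<s gi≡0
...   | inj₂ refl = ⊥-elim (0≢1+n (trans (sym gi≡0) eq))

noZero-1 : ∀ g {s} → (∀ {i} → i < s → g i ≢ 0) → noZero g s ≡ 1
noZero-1 g {zero}  _   = refl
noZero-1 g {suc s} all with g s in eq
... | zero  = ⊥-elim (all ≤-refl eq)
... | suc _ = noZero-1 g (λ i<s → all (m<n⇒m<1+n i<s))

-- Cantor pairing

triangle-mono : ∀ {a b} → a ≤ b → triangle a ≤ triangle b
triangle-mono z≤n       = z≤n
triangle-mono (s≤s a≤b) = +-mono-≤ (s≤s a≤b) (triangle-mono a≤b)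

n≤triangle : ∀ n → n ≤ triangle n
n≤triangle zero    = z≤n
n≤triangle (suc n) = m≤m+n (suc n) (triangle n)

-- The components of a coded pair: w = ⟨ a , b ⟩ lies on the diagonal a + b,
-- which is the least s with w < triangle (suc s), and b = w ∸ triangle s.
diagonal π₁ π₂ : ℕ → ℕ
diagonal w = least (λ s → suc w ∸ triangle (suc s)) w
π₂ w = w ∸ triangle (diagonal w)
π₁ w = diagonal w ∸ π₂ w

diagonalₜ π₁ₜ π₂ₜ : Total n → Total n
diagonalₜ a = call (call (leastₜ (sucₜ v1 ∸ₜ triangleₜ (sucₜ v0))) (v0 ∷ v0 ∷ [])) (a ∷ [])
π₂ₜ a = a ∸ₜ triangleₜ (diagonalₜ a)
π₁ₜ a = diagonalₜ a ∸ₜ π₂ₜ a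

diagonal-⟨⟩ : ∀ a b → diagonal ⟨ a , b ⟩ ≡ a + b
diagonal-⟨⟩ a b = least-finds _
  (m≤n⇒m∸n≡0 (subst (_≤ triangle (suc (a + b))) (+-suc _ b)
    (subst (triangle (a + b) + suc b ≤_) (+-comm (triangle (a + b)) (suc (a + b)))
      (+-monoʳ-≤ (triangle (a + b)) (s≤s (m≤n+m b a))))))
  (λ {i} i< e → <⇒≱ (≤-<-trans (≤-trans (triangle-mono i<) (m≤m+n _ b)) (n<1+n _)) (m∸n≡0⇒m≤n e))
  (≤-trans (n≤triangle (a + b)) (m≤m+n _ b))

π₂-⟨⟩ : ∀ a b → π₂ ⟨ a , b ⟩ ≡ b
π₂-⟨⟩ a b rewrite diagonal-⟨⟩ a b = m+n∸m≡n (triangle (a + b)) b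

π₁-⟨⟩ : ∀ a b → π₁ ⟨ a , b ⟩ ≡ a
π₁-⟨⟩ a b rewrite π₂-⟨⟩ a b | diagonal-⟨⟩ a b = m+n∸n≡m a b

π₂≤⟨⟩ : ∀ a b → b ≤ ⟨ a , b ⟩
π₂≤⟨⟩ a b = m≤n+m b (triangle (a + b))

-- Interleaving

evens odds : Baire → Baire
evens z n = z (n + n)
odds z n  = z (suc (n + n))

evens-⟪⟫ : ∀ p q → evens ⟪ p , q ⟫ ≗ p
odds-⟪⟫  : ∀ p q → odds ⟪ p , q ⟫ ≗ q
evens-⟪⟫ p q zero    = refl
evens-⟪⟫ p q (suc n) =
  trans (cong ⟪ q , p ∘ suc ⟫ (+-suc n n)) (odds-⟪⟫ q (p ∘ suc) n)
odds-⟪⟫ p q n = evens-⟪⟫ q (p ∘ suc) n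

evensₜ oddsₜ : Total n → Total n
evensₜ a = ask (a +ₜ a)
oddsₜ a  = ask (sucₜ (a +ₜ a))

-- The remainder and the quotient of division by 2.
parity half : ℕ → ℕ
parity = iter 0 (λ _ y → ifz y 1 0)
half   = iter 0 (λ n y → ifz (parity n) y (suc y))

⟪⟫-halves : ∀ p q n → ⟪ p , q ⟫ n ≡ ifz (parity n) (p (half n)) (q (half n))
⟪⟫-halves p q zero    = refl
⟪⟫-halves p q (suc n) with parity n | ⟪⟫-halves q (p ∘ suc) n
... | zero  | e = e
... | suc _ | e = e

parityₜ halfₜ : Total n → Total n
parityₜ a = call (as (primrec zeroₜ (ifzₜ v1 (sucₜ zeroₜ) zeroₜ)) (unary parity)
  (λ { p (a ∷ []) → refl })) (a ∷ [])
halfₜ a = call (as (primrec zeroₜ (ifzₜ (parityₜ v0) v1 (sucₜ v1))) (unary half)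
  (λ { p (a ∷ []) → refl })) (a ∷ [])

-- ⟪ F , G ⟫ in the first argument, with common parameters.
interleaveₜ : Total (1 + n) → Total (1 + n) → Total (1 + n)
interleaveₜ F G = as
  (ifzₜ (parityₜ v0) (plug 1 F (halfₜ v0 ∷ [])) (plug 1 G (halfₜ v0 ∷ [])))
  (λ { p (i ∷ xs) → ⟪ (λ j → fun F p (j ∷ xs)) , (λ j → fun G p (j ∷ xs)) ⟫ i })
  (λ { p (i ∷ xs) → sym (⟪⟫-halves _ _ i) })

-- Step-bounded simulation

Eventually : (ℕ → Set) → Set
Eventually P = ∃[ S ] ∀ s → S ≤ s → P s

always : {P : ℕ → Set} → (∀ s → P s) → Eventually P
always h = 0 , λ s _ → h s

eventually₂ : {P Q R : ℕ → Set} → (∀ s → P s → Q s → R s) →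
              Eventually P → Eventually Q → Eventually R
eventually₂ f (S , h) (T , k) = S ⊔ T , λ s le →
  f s (h s (≤-trans (m≤m⊔n S T) le)) (k s (≤-trans (m≤n⊔m S T) le))

-- Finitely many eventual statements eventually hold together.
eventually-below : {P : ℕ → ℕ → Set} (y : ℕ) → (∀ i → i < y → Eventually (P i)) →
                   Eventually (λ s → ∀ i → i < y → P i s)
eventually-below     zero    h = always (λ s i ())
eventually-below {P} (suc y) h =
  eventually₂ combine (h y ≤-refl) (eventually-below y (λ i i<y → h i (m<n⇒m<1+n i<y)))
  where
  combine : ∀ s → P y s → (∀ i → i < y → P i s) → ∀ i → i < suc y → P i s
  combine s Pys below i i< with m≤n⇒m<n∨m≡n (≤-pred i<)
  ... | inj₁ i<y  = below i i<y
  ... | inj₂ refl = Pys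

-- The oracle of the simulated program may depend on the stage s and is given
-- by O as a function of s and the position.
module Simulation (O : Total 2) where

  -- Nonzero iff all gs are nonzero.
  defined : Vec (Total n) m → Total n
  defined []       = sucₜ zeroₜ
  defined (g ∷ gs) = ifzₜ g zeroₜ (defined gs)

  preds : Vec (Total n) m → Vec (Total n) m
  preds []       = []
  preds (g ∷ gs) = predₜ g ∷ preds gs

  -- The value at (s , xs) is 0 if no result for xs has been found by stage s,
  -- and suc v if the result v has been found.  Only the search in mu is bounded
  -- by s, while primitive recursions are carried out in full.
  mutual
    approx : Prog n → Total (1 + n)
    approx zero        = sucₜ zeroₜ
    approx succ        = sucₜ (sucₜ v1)
    approx (proj i)    = sucₜ (var (suc i))
    approx oracle      = sucₜ O
    approx (comp f gs) =
      ifzₜ (defined (approxs gs)) zeroₜ (call (approx f) (v0 ∷ preds (approxs gs)))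
    approx (prec f g)  = plug 2
      (primrec (approx f) (ifzₜ v1 zeroₜ (plug 3 (approx g) (v2 ∷ v0 ∷ predₜ v1 ∷ []))))
      (v1 ∷ v0 ∷ [])
    approx (mu f)      = ifzₜ at zeroₜ (ifzₜ (predₜ at) (sucₜ first) zeroₜ)
      where
      -- pred of an approximation is zero iff the approximation is undefined or
      -- finds the value 0; either of these ends the search.
      first = plug 1 (leastₜ (predₜ (plug 2 (approx f) (v1 ∷ v0 ∷ [])))) (v0 ∷ v0 ∷ [])
      at    = plug 1 (approx f) (v0 ∷ first ∷ [])

    approxs : Vec (Prog n) m → Vec (Total (1 + n)) m
    approxs []       = []
    approxs (g ∷ gs) = approx g ∷ approxs gs

  module _ (p : Baire) where

    -- The oracle of stage s.
    O[_] : ℕ → Baire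
    O[ s ] x = fun O p (s ∷ x ∷ [])

    -- A result found at stage s is a result relative to the oracle of stage s.
    mutual
      sound : ∀ (e : Prog n) s xs {v} → fun (approx e) p (s ∷ xs) ≡ suc v → Eval O[ s ] e xs v
      sound zero     s xs       refl = zero
      sound succ     s (x ∷ []) refl = succ
      sound (proj i) s xs       refl = proj i
      sound oracle   s (x ∷ []) refl = oracle
      sound (comp f gs) s xs eq with fun (defined (approxs gs)) p (s ∷ xs) in d
      ... | suc _ = comp (sounds gs s xs d) (sound f s _ eq)
      sound (prec f g) s (k ∷ xs) eq = go k eq
        where
        go : ∀ k {v} → fun (approx (prec f g)) p (s ∷ k ∷ xs) ≡ suc v →
             Eval O[ s ] (prec f g) (k ∷ xs) v
        go zero    eq = prec0 (sound f s xs eq)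
        go (suc k) eq with fun (approx (prec f g)) p (s ∷ k ∷ xs) in d
        ... | suc y = precS (go k d) (sound g s _ eq)
      sound (mu f) s xs eq
        with least (λ y → pred (fun (approx f) p (s ∷ y ∷ xs))) s
           | least-minimal (λ y → pred (fun (approx f) p (s ∷ y ∷ xs))) s
      ... | y | below with fun (approx f) p (s ∷ y ∷ xs) in d
      sound (mu f) s xs refl | y | below | suc zero = mu positive (sound f s _ d)
        where
        positive : ∀ i → i < y → ∃[ k ] Eval O[ s ] f (i ∷ xs) (suc k)
        positive i i<y with fun (approx f) p (s ∷ i ∷ xs) in d′ | below i<y
        ... | zero        | ≢0 = ⊥-elim (≢0 refl)
        ... | suc zero    | ≢0 = ⊥-elim (≢0 refl)
        ... | suc (suc k) | _  = k , sound f s _ d′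

      sounds : ∀ (gs : Vec (Prog n) m) s xs {v} →
               fun (defined (approxs gs)) p (s ∷ xs) ≡ suc v →
               Evals O[ s ] gs xs (values (preds (approxs gs)) p (s ∷ xs))
      sounds []       s xs eq = []
      sounds (g ∷ gs) s xs eq with fun (approx g) p (s ∷ xs) in d
      ... | suc y = sound g s xs d ∷ sounds gs s xs eq

    module _ {q : Baire} where

      Halts : Prog n → Vec ℕ n → ℕ → ℕ → Set
      Halts e xs v s = O[ s ] ≗ q → fun (approx e) p (s ∷ xs) ≡ suc v

      AllHalt : Vec (Prog n) m → Vec ℕ n → Vec ℕ m → ℕ → Set
      AllHalt gs xs ys s = O[ s ] ≗ q →
        fun (defined (approxs gs)) p (s ∷ xs) ≡ 1 ×
        values (preds (approxs gs)) p (s ∷ xs) ≡ ys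

      -- Every computation relative to q is found at all sufficiently late stages
      -- whose oracle is q.
      mutual
        complete : ∀ {e : Prog n} {xs v} → Eval q e xs v → Eventually (Halts e xs v)
        complete zero     = always (λ _ _ → refl)
        complete succ     = always (λ _ _ → refl)
        complete (proj i) = always (λ _ _ → refl)
        complete (oracle {x}) = always (λ s O≗q → cong suc (O≗q x))
        complete (comp {f = f} {gs} {xs} {ys} {z} ds d) =
          eventually₂ step (completes ds) (complete d)
          where
          step : ∀ s → AllHalt gs xs ys s → Halts f ys z s → Halts (comp f gs) xs z s
          step s hs h O≗q with hs O≗q
          ... | d≡1 , e rewrite d≡1 | e = h O≗q
        complete (prec0 d) = complete d
        complete (precS {f = f} {g} {xs} {k} {y} {z} d d′) =
          eventually₂ step (complete d) (complete d′)
          where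
          step : ∀ s → Halts (prec f g) (k ∷ xs) y s → Halts g (k ∷ y ∷ xs) z s →
                 Halts (prec f g) (suc k ∷ xs) z s
          step s h h′ O≗q rewrite h O≗q = h′ O≗q
        complete (mu {f = f} {xs} {y} h d) =
          eventually₂ (λ s (y≤s , b) a → step s y≤s b a)
            (eventually₂ (λ s → _,_) (y , λ s y≤s → y≤s)
              (eventually-below {Positive} y (λ i i<y →
                let S , halts = complete (proj₂ (h i i<y)) in S , λ s S≤s O≗q → _ , halts s S≤s O≗q)))
            (complete d)
          where
          Positive : ℕ → ℕ → Set
          Positive i s = O[ s ] ≗ q → ∃[ k ] fun (approx f) p (s ∷ i ∷ xs) ≡ suc (suc k)
          step : ∀ s → y ≤ s → (∀ i → i < y → Positive i s) →
                 Halts f (y ∷ xs) 0 s → Halts (mu f) xs y s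
          step s y≤s below at O≗q
            rewrite least-finds (λ i → pred (fun (approx f) p (s ∷ i ∷ xs))) {s} {y}
                      (cong pred (at O≗q))
                      (λ {i} i<y e → 0≢1+n (trans (sym e) (cong pred (proj₂ (below i i<y O≗q))))) y≤s
                  | at O≗q = refl

        completes : ∀ {gs : Vec (Prog n) m} {xs ys} → Evals q gs xs ys →
                    Eventually (AllHalt gs xs ys)
        completes [] = always (λ _ _ → refl , refl)
        completes (_∷_ {g = g} {gs} {xs} {y} {ys} d ds) =
          eventually₂ step (complete d) (completes ds)
          where
          step : ∀ s → Halts g xs y s → AllHalt gs xs ys s → AllHalt (g ∷ gs) xs (y ∷ ys) s
          step s h hs O≗q rewrite h O≗q with hs O≗q
          ... | d≡1 , e = d≡1 , cong (y ∷_) e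

-- Unbounded search

least-zero : ∀ g s → g s ≡ 0 → g (least g s) ≡ 0
least-zero g s gs≡0 = decidable-stable (_ ≟ 0) λ ≢0 →
  ≢0 (trans (cong g (least-stuck g s ≢0)) gs≡0)

-- G at (t , xs), where t is the least zero of F in its first argument.
search : Total (1 + n) → Total (1 + n) → Prog n
search F G = comp (prog G) (mu (prog F) ∷ progs (later 0))

search-finds : ∀ (F G : Total (1 + n)) p xs {s} → fun F p (s ∷ xs) ≡ 0 →
  ∃[ t ] fun F p (t ∷ xs) ≡ 0 × Eval p (search F G) xs (fun G p (t ∷ xs))
search-finds F G p xs {s} Fs≡0 = t , Ft≡0 , comp (minimal ∷ rest) (correct G p (t ∷ xs))
  where
  g : ℕ → ℕ
  g y = fun F p (y ∷ xs)
  t = least g s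
  Ft≡0 = least-zero g s Fs≡0
  positive : ∀ i → i < t → ∃[ k ] Eval p (prog F) (i ∷ xs) (suc k)
  positive i i<t with g i in eq | least-minimal g s i<t
  ... | zero  | ≢0 = ⊥-elim (≢0 refl)
  ... | suc k | _  = k , subst (Eval p (prog F) (i ∷ xs)) eq (correct F p (i ∷ xs))
  minimal : Eval p (mu (prog F)) xs t
  minimal = mu positive (subst (Eval p (prog F) (t ∷ xs)) Ft≡0 (correct F p (t ∷ xs)))
  rest : Evals p (progs (later 0)) xs xs
  rest = subst (Evals p (progs (later 0)) xs) (values-plug 0 [] p xs) (corrects (later 0) p xs)

-- Listing numbers by dovetailed simulation

-- For each n, the program e is run on n for n + t steps with the oracle of
-- stage n + t given by I, for t = 0, 1, ... until a result is found; then n is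
-- listed iff the result is 1.  Starting with stage n ensures that almost all
-- numbers are unaffected by the early, wrong oracles.
module Dovetailing (I : Total 2) (e : Prog 1) where

  open Simulation I

  -- In these functions the first argument is t and the second is n.  The value 2
  -- of stageₜ stands for the result 1.
  stageₜ haltsₜ listₜ : Total 2
  stageₜ = call (approx e) (v1 +ₜ v0 ∷ v1 ∷ [])
  haltsₜ = ifzₜ stageₜ (sucₜ zeroₜ) zeroₜ
  listₜ  = ifzₜ (distanceₜ stageₜ (sucₜ (sucₜ zeroₜ))) (sucₜ v1) zeroₜ

  lister : Machine
  lister = search haltsₜ listₜ

  -- The oracles of the stages are eventually equal to q, and e computes v from q.
  module Convergent (p : Baire) {q v : Baire} (I→q : Eventually (λ s → O[_] p s ≗ q))
                    (qv : rel (graph ⟦ e ⟧) q v) where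

    private
      S = proj₁ I→q

      I≗q : ∀ s → S ≤ s → O[_] p s ≗ q
      I≗q = proj₂ I→q

    -- The search for n ends with t, and its output determines what is listed.
    EndsAt : ℕ → ℕ → Set
    EndsAt n t = fun haltsₜ p (t ∷ n ∷ []) ≡ 0 × Eval p lister (n ∷ []) (fun listₜ p (t ∷ n ∷ []))

    found : ∀ n → ∃[ t ] EndsAt n t
    found n = search-finds haltsₜ listₜ p (n ∷ []) {S ⊔ T}
      (cong (λ x → ifz x 1 0) (proj₂ halts (n + (S ⊔ T)) (≤-trans (m≤n⊔m S T) (m≤n+m _ n))
        (I≗q (n + (S ⊔ T)) (≤-trans (m≤m⊔n S T) (m≤n+m _ n)))))
      where
      halts : Eventually _
      halts = complete p (qv n)
      T = proj₁ halts

    -- At stage n, nothing but n may be listed.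
    listing : Baire
    listing n = fun listₜ p (proj₁ (found n) ∷ n ∷ [])

    lister-listing : rel (graph ⟦ lister ⟧) p listing
    lister-listing n = proj₂ (proj₂ (found n))

    listing-self : ∀ {n} → listing lists n → listing n ≡ suc n
    listing-self {n} (i , eq) = subst (λ j → listing j ≡ suc n) i≡n eq
      where
      ifz-suc : ∀ c {a b} → ifz c (suc a) 0 ≡ suc b → a ≡ b
      ifz-suc zero refl = refl
      i≡n : i ≡ n
      i≡n = ifz-suc (distance (fun stageₜ p (proj₁ (found i) ∷ i ∷ [])) 2) eq

    listing-eventually : ∀ n → S ≤ n → listing n ≡ ifz (distance (suc (v n)) 2) (suc n) 0
    listing-eventually n S≤n = cong (λ x → ifz (distance x 2) (suc n) 0)
      (value _ refl (proj₁ (proj₂ (found n))))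
      where
      t = proj₁ (found n)
      value : ∀ x → fun (approx e) p (n + t ∷ n ∷ []) ≡ x → ifz x 1 0 ≡ 0 →
              fun (approx e) p (n + t ∷ n ∷ []) ≡ suc (v n)
      value (suc w) eq _ = trans eq (cong suc (Eval-det
        (Eval-resp (I≗q (n + t) (≤-trans S≤n (m≤m+n n t))) (sound p e (n + t) (n ∷ []) eq))
        (qv n)))

-- Weihrauch reductions by machines

output : Total 1 → Baire → Baire
output F p n = fun F p (n ∷ [])

computes : ∀ (F : Total 1) p → rel (graph ⟦ prog F ⟧) p (output F p)
computes F p n = correct F p (n ∷ [])

-- The composite K ⟨id, GH⟩ is defined as soon as its parts are defined along
-- the given names, because all of them are single-valued on names.
∘-defined : ∀ (K G H : 𝔹 ⇀ 𝔹) {p h g k} →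
  rel (graph H) p h → rel (graph G) h g → rel (graph K) ⟪ p , g ⟫ k →
  rel (graph (K ∘ₚ ⟪id, G ∘ₚ H ⟫)) p k
∘-defined K G H {p} {h} {g} {k} Hph Ghg Kpgk =
  (λ z Fpz → k , resp (graph K) (functional F Fpg Fpz) (λ _ → refl) Kpgk) , ⟪ p , g ⟫ , Fpg , Kpgk
  where
  F = ⟪id, G ∘ₚ H ⟫
  Fpg : rel (graph F) p ⟪ p , g ⟫
  Fpg = g , ((λ h′ Hph′ → g , resp (graph G) (functional H Hph Hph′) (λ _ → refl) Ghg) ,
             h , Hph , Ghg) , λ _ → refl

-- Limits, finite sets and solutions of the implication

⟪⟫-const : ∀ c → const c ≗ ⟪ const c , const c ⟫
⟪⟫-const c zero    = refl
⟪⟫-const c (suc n) = ⟪⟫-const c n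

lim-unique : ∀ {u v n a} → rel (fun Lim) u v → Eventually (λ i → u ⟨ n , i ⟩ ≡ a) → v n ≡ a
lim-unique {n = n} uv (l , e) with uv n
... | k , e′ = trans (sym (e′ (k ⊔ l) (m≤m⊔n k l))) (e (k ⊔ l) (m≤n⊔m k l))

finite-bounded : ∀ {P : Pred ℕ 0ℓ} → Finite P → ∃[ b ] ∀ n → n ∈ P → n < b
finite-bounded (ns , h) = bound ns , λ n Pn → below (h n Pn)
  where
  bound : List ℕ → ℕ
  bound []       = 0
  bound (n ∷ ns) = suc n ⊔ bound ns
  below : ∀ {n ns} → n ∈ˡ ns → n < bound ns
  below {ns = m ∷ ns} (here refl) = m≤m⊔n (suc m) (bound ns)
  below {ns = m ∷ ns} (there n∈)  = ≤-trans (below n∈) (m≤n⊔m (suc m) (bound ns))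

module Proof (em : ExcludedMiddle 0ℓ) (U : Machine) (universal : Universal U) where

  Implication = implication U (Cℕ em) (Cℕ-dom-nonempty em) Lim

  stable : ∀ {P : Set} → ¬ ¬ P → P
  stable = decidable-stable em

  -- The element of the function space with name s.
  ℳ-element : Baire → Setoid.Carrier (set (ℳ U ℕSpace BaireSpace))
  ℳ-element s = Φ[ ℕSpace , BaireSpace ] U s , s , λ x y → mk⇔ id id

  -- Any q with q 0 in B is a cylindrified name of an element of B.  If the
  -- function with index s maps all of them to a limit v of u, then (H , B) is a
  -- solution at u, where H has the name s.
  solution : ∀ {u v s} {B : Pred ℕ 0ℓ} {y} → y ∈ B → rel (fun Lim) u v →
    (∀ q → q 0 ∈ B → rel (graph (Φ U s)) q v) → rel (fun Implication) u (ℳ-element s , B)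
  solution {u} {v} {s} {B} {y} By uv Φv =
    (v , uv) , (v , applied) ,
    λ { v′ (_ , y′ , By′ , _ , r , (_ , q , (a , b , q≗ , a≡) , Φr) , r≗v′) →
        resp (fun Lim) {x = u} (λ _ → refl)
          (λ n → trans (functional (Φ U s) (Φv q (subst B (sym (trans (q≗ 0) a≡)) By′)) Φr n) (r≗v′ n))
          uv }
    where
    value : ∀ y → y ∈ B → rel (Φ[ ℕSpace , BaireSpace ] U s) y v
    value y By =
      (λ r _ → r , λ _ → refl) , v ,
      ((λ { q (a , b , q≗ , a≡) → v , Φv q (subst B (sym (trans (q≗ 0) a≡)) By) }) ,
       const y , (const y , const y , ⟪⟫-const y , refl) , Φv (const y) By) ,
      λ _ → refl
    applied : rel (Φ[ ℕSpace , BaireSpace ] U s ⊙ fun (Cℕ em)) B v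
    applied = (λ y By → v , value y By) , y , By , value y By

  -- Conversely, from the name const y of an element y of B, any name of the first
  -- component of a solution computes a limit of u.
  solution-computes : ∀ {u H B h} → rel (fun Implication) u (H , B) →
    rel (graph (δ (ℳ U ℕSpace BaireSpace))) h H → ∀ {y} → y ∈ B →
    ∃[ v ] rel (fun Lim) u v × rel (graph (Φ U h)) (const y) v
  solution-computes {H = H , _} {h = h} (_ , (_ , ⊆H , _) , ⊆Lim) hH {y} By
    with v , Hyv ← ⊆H y By
    with _ , _ , (⊆Φ , _) , _ ← from (hH y v) Hyv
    with r , Φr ← ⊆Φ (const y) (const y , const y , ⟪⟫-const y , refl) =
    r , ⊆Lim r (⊆H , y , By , to (hH y r)
      ((λ r′ _ → r′ , λ _ → refl) , r ,
       (⊆Φ , const y , (const y , const y , ⟪⟫-const y , refl) , Φr) , λ _ → refl)) , Φr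

  least-element : ∀ {B : Pred ℕ 0ℓ} y → y ∈ B → ∃[ z ] z ∈ B × (∀ i → i < z → i ∉ B)
  least-element {B} y By = go (suc y) y ≤-refl By
    where
    go : ∀ b y → y < b → y ∈ B → ∃[ z ] z ∈ B × (∀ i → i < z → i ∉ B)
    go (suc b) y y<b By with em {∃[ i ] i < y × i ∈ B}
    ... | yes (i , i<y , Bi) = go b i (≤-trans i<y (≤-pred y<b)) Bi
    ... | no ∄ = y , By , λ i i<y Bi → ∄ (i , i<y , Bi)

  -- Almost-EC is reducible to the implication

  -- unlisted p n i is 0 if p lists n before stage i, and 1 otherwise.
  unlisted : Baire → ℕ → ℕ → ℕ
  unlisted p n = noZero (λ j → distance (p j) (suc n))

  unlisted-listed : ∀ {p n} → p lists n → Eventually (λ i → unlisted p n i ≡ 0)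
  unlisted-listed {p} {n} (j , pj≡) = suc j , λ i j<i → noZero-0 _ j<i
    (trans (cong (λ x → distance x (suc n)) pj≡) (distance-0 (suc n)))

  unlisted-unlisted : ∀ {p n} → ¬ p lists n → ∀ i → unlisted p n i ≡ 1
  unlisted-unlisted ¬l i = noZero-1 _ {i} (λ {j} _ e → ¬l (j , distance≡0⇒≡ _ _ e))

  -- The sequence whose value at ⟨ n , i ⟩ is unlisted p n i.
  stagesₜ : Total 1
  stagesₜ = call (noZeroₜ (distanceₜ (ask v0) (sucₜ v1))) (π₂ₜ v0 ∷ π₁ₜ v0 ∷ [])

  stages-⟨⟩ : ∀ p n i → output stagesₜ p ⟨ n , i ⟩ ≡ unlisted p n i
  stages-⟨⟩ p n i = cong₂ (unlisted p) (π₁-⟨⟩ n i) (π₂-⟨⟩ n i)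

  -- The characteristic function of A.
  χ : Pred ℕ 0ℓ → Baire
  χ A n with em {A n}
  ... | yes _ = 1
  ... | no _  = 0

  stages-converge : ∀ {p A} → rel (graph (δ (𝒜ℕ em))) p A → rel (fun Lim) (output stagesₜ p) (χ A)
  stages-converge {p} {A} pA n with em {A n}
  ... | yes An = always {λ i → output stagesₜ p ⟨ n , i ⟩ ≡ 1} λ i →
          trans (stages-⟨⟩ p n i) (unlisted-unlisted (λ l → to (pA n) l An) i)
  ... | no ¬An with k , e ← unlisted-listed (from (pA n) ¬An) =
          k , λ i k≤i → trans (stages-⟨⟩ p n i) (e i k≤i)

  -- The least number that b has not listed before stage s: the current guess for
  -- the least element of the set whose complement b enumerates.
  guess : Baire → ℕ → ℕ
  guess b s = least (λ y → ifz (unlisted b y s) 1 0) s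

  guess-least : ∀ {b B y} → rel (graph (δ (𝒜ℕ em))) b B → y ∈ B → (∀ i → i < y → i ∉ B) →
                Eventually (λ s → guess b s ≡ y)
  guess-least {b} {B} {y} bB By below =
    eventually₂ step (y , λ s y≤s → y≤s)
      (eventually-below {λ i s → unlisted b i s ≡ 0} y
        (λ i i<y → unlisted-listed (from (bB i) (below i i<y))))
    where
    step : ∀ s → y ≤ s → (∀ i → i < y → unlisted b i s ≡ 0) → guess b s ≡ y
    step s y≤s listed = least-finds _
      (cong (λ x → ifz x 1 0) (unlisted-unlisted (λ l → to (bB y) l By) s))
      (λ {i} i<y e → 1+n≢0 (trans (cong (λ x → ifz x 1 0) (sym (listed i i<y))) e)) y≤s

  -- The oracle of the machine below is ⟪ p , ⟪ h , b ⟫ ⟫, where h names the first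
  -- and b the second component of a solution.  Thus b is read at the odd places
  -- of the odd places, and h at the even places of the odd places.
  guessₜ : Total n → Total n
  guessₜ a = call (call (leastₜ
    (ifzₜ (call (noZeroₜ (distanceₜ (oddsₜ (sucₜ (v0 +ₜ v0))) (sucₜ v1))) (v1 ∷ v0 ∷ []))
          (sucₜ zeroₜ) zeroₜ)) (v0 ∷ v0 ∷ [])) (a ∷ [])

  -- At stage s the universal machine is given ⟪ h , const (guess b s) ⟫.
  inputₜ : Total 2
  inputₜ = call (interleaveₜ (oddsₜ (v0 +ₜ v0)) (guessₜ v1)) (v1 ∷ v0 ∷ [])

  open Dovetailing inputₜ U

  -- If l lists each number, if at all, also at the stage of that number, and from
  -- stage S on does so exactly for the elements of A, then the set listed by l
  -- differs from A in finitely many numbers.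
  eventually-decides : ∀ {A l} S → (∀ {n} → l lists n → l n ≡ suc n) →
    (∀ n → S ≤ n → l n ≡ ifz (distance (suc (χ A n)) 2) (suc n) 0) →
    rel (fun (AlmostEC em)) A (l lists_)
  eventually-decides {A} {l} S self eventual =
    upTo S , λ n n∈ → ∈-upTo⁺ (≰⇒> (λ S≤n → agree n S≤n n∈))
    where
    agree : ∀ n → S ≤ n → ¬ ((n ∈ A × ¬ l lists n) ⊎ (l lists n × n ∉ A))
    agree n S≤n n∈ with em {A n} | eventual n S≤n
    agree n S≤n (inj₁ (An , ¬listed)) | yes _  | e = ¬listed (n , e)
    agree n S≤n (inj₁ (An , _)) | no ¬An | e = ¬An An
    agree n S≤n (inj₂ (_ , ¬An)) | yes An | e = ¬An An
    agree n S≤n (inj₂ (listed , _)) | no _ | e = 0≢1+n (trans (sym e) (self listed))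

  -- (h , b) names a solution (H , B) at u, y is the least element of B, and v is
  -- the value of H at y.
  module AlmostEnumeration {z h b u A B y v}
    (lim-χ : rel (fun Lim) u (χ A)) (lim-v : rel (fun Lim) u v)
    (z≗h : evens (odds z) ≗ h) (z≗b : odds (odds z) ≗ b)
    (bB : rel (graph (δ (𝒜ℕ em))) b B)
    (By : y ∈ B) (minimal : ∀ i → i < y → i ∉ B)
    (Φv : rel (graph (Φ U h)) (const y) v)
    where

    v≡χ : ∀ n → v n ≡ χ A n
    v≡χ n = lim-unique {u = u} lim-v (lim-χ n)

    input-correct : Eventually (λ s → (λ x → fun inputₜ z (s ∷ x ∷ [])) ≗ ⟪ h , const y ⟫)
    input-correct with S , e ← guess-least
      (resp (graph (δ (𝒜ℕ em))) {y = B} (λ n → sym (z≗b n)) (id , id) bB) By minimal =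
      S , λ s S≤s → ⟪⟫-cong z≗h (λ _ → e s S≤s)

    open Convergent z input-correct Φv public

    S : ℕ
    S = proj₁ input-correct

    almost : rel (fun (AlmostEC em)) A (listing lists_)
    almost = eventually-decides S listing-self (λ n S≤n → trans (listing-eventually n S≤n)
      (cong (λ x → ifz (distance (suc x) 2) (suc n) 0) (v≡χ n)))

  -- The listing machine turns any name g of a solution into an almost enumeration.
  enumerates : ∀ {p u A g H B} → rel (fun Lim) u (χ A) →
    rel (graph (δ (ℳ U ℕSpace BaireSpace ×ʳ 𝒜ℕ em))) g (H , B) →
    rel (fun Implication) u (H , B) →
    ∃[ l ] rel (graph ⟦ lister ⟧) ⟪ p , g ⟫ l × rel (fun (AlmostEC em)) A (l lists_)
  enumerates {p} {u} {A} {g} {H} {B} lim-χ (h , b , g≗ , hH , bB) sol@(_ , (_ , _ , y₀ , By₀ , _) , _) =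
    let y , By , minimal = least-element {B} y₀ By₀
        v , lim-v , Φv   = solution-computes {u} {H} {B} {h} sol hH By
        module E = AlmostEnumeration {⟪ p , g ⟫} {h} {b} {u} {A} {B} {y} {v} lim-χ lim-v
          (λ n → trans (odds-⟪⟫ p g (n + n)) (trans (g≗ (n + n)) (evens-⟪⟫ h b n)))
          (λ n → trans (odds-⟪⟫ p g (suc (n + n))) (trans (g≗ (suc (n + n))) (odds-⟪⟫ h b n)))
          bB By minimal Φv
    in E.listing , E.lister-listing , E.almost

  -- Every convergent u has a solution, namely a constant function on all of ℕ; its
  -- name comes from the machine that outputs its parameter.
  convergent-solvable : ∀ u {v} → rel (fun Lim) u v → u ∈ dom (fun Implication)
  convergent-solvable u {v} uv with S , total , S-spec ← universal (prog (evensₜ v0))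
    with s , Ss ← total v =
    (ℳ-element s , λ _ → ⊤) ,
    solution {u = u} {v = v} {s = s} {B = λ _ → ⊤} {y = 0} _ uv (λ q _ → from (S-spec v s Ss q v)
      (λ n → subst (Eval ⟪ v , q ⟫ (prog (evensₜ v0)) (n ∷ [])) (evens-⟪⟫ v q n)
                   (correct (evensₜ v0) ⟪ v , q ⟫ (n ∷ []))))

  AlmostEC≤implication : AlmostEC em ≤W Implication
  AlmostEC≤implication = ⟦ K ⟧ , ⟦ prog stagesₜ ⟧ , (K , λ _ _ r → r) , (prog stagesₜ , λ _ _ r → r) , reduces
    where
    K : Machine
    K = lister
    reduces : ∀ G → G ⊢ Implication → (⟦ K ⟧ ∘ₚ ⟪id, G ∘ₚ ⟦ prog stagesₜ ⟧ ⟫) ⊢ AlmostEC em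
    reduces G G⊢ p A pA _ =
      let g , Gg , (H , B) , name , sol = G⊢ (output stagesₜ p) (output stagesₜ p) (λ _ → refl)
                                            (convergent-solvable (output stagesₜ p) (stages-converge pA))
          l , Kl , l-almost = enumerates {u = output stagesₜ p} {H = H} (stages-converge pA) name sol
      in l , ∘-defined ⟦ K ⟧ G ⟦ prog stagesₜ ⟧ (computes stagesₜ p) Gg Kl ,
         l lists_ , (λ n → mk⇔ id id) , l-almost

  -- The implication is reducible to Almost-EC

  -- The codes m of pairs (n , k) such that u(n,i) does not change for i ≥ k.
  Settled : Baire → Pred ℕ 0ℓ
  Settled u m = ∀ j → u ⟨ π₁ m , π₂ m + j ⟩ ≡ u ⟨ π₁ m , π₂ m ⟩

  -- Stage ⟨ m , j ⟩ of changes u lists m if j witnesses that m is not settled.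
  changeAt : ℕ → ℕ → ℕ → ℕ
  changeAt new old m = ifz (distance new old) 0 (suc m)

  changes : Baire → Baire
  changes u i = changeAt (u ⟨ π₁ (π₁ i) , π₂ (π₁ i) + π₂ i ⟩) (u ⟨ π₁ (π₁ i) , π₂ (π₁ i) ⟩) (π₁ i)

  -- The argument u is the operation by which the sequence u is read, as its place
  -- in the oracle varies.
  changesₜ : (∀ {n} → Total n → Total n) → Total n → Total n
  changesₜ u i = ifzₜ (distanceₜ (u (pairₜ (π₁ₜ (π₁ₜ i)) (π₂ₜ (π₁ₜ i) +ₜ π₂ₜ i)))
                                 (u (pairₜ (π₁ₜ (π₁ₜ i)) (π₂ₜ (π₁ₜ i)))))
                      zeroₜ (sucₜ (π₁ₜ i))

  changes-correct : ∀ u → rel (graph ⟦ prog (changesₜ ask v0) ⟧) u (changes u)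
  changes-correct u n = correct (changesₜ ask v0) u (n ∷ [])

  changes-name : ∀ u → rel (graph (δ (𝒜ℕ em))) (changes u) (Settled u)
  changes-name u m = mk⇔ (λ (i , e) → sound i e) complete
    where
    sound : ∀ i → changes u i ≡ suc m → m ∉ Settled u
    sound i e = go _ refl e
      where
      go : ∀ d → distance (u ⟨ π₁ (π₁ i) , π₂ (π₁ i) + π₂ i ⟩) (u ⟨ π₁ (π₁ i) , π₂ (π₁ i) ⟩) ≡ d →
           ifz d 0 (suc (π₁ i)) ≡ suc m → m ∉ Settled u
      go (suc d) d≡ e settled = 0≢1+n (trans (sym (distance-0 (u ⟨ π₁ (π₁ i) , π₂ (π₁ i) ⟩)))
        (trans (cong (λ x → distance x (u ⟨ π₁ (π₁ i) , π₂ (π₁ i) ⟩)) (sym (settled′ (π₂ i)))) d≡))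
        where
        settled′ : Settled u (π₁ i)
        settled′ = subst (Settled u) (sym (suc-injective e)) settled
    complete : m ∉ Settled u → changes u lists m
    complete unsettled =
      let j , ≢ = stable λ ∄ → unsettled λ j → stable λ ≢ → ∄ (j , ≢)
      in ⟨ m , j ⟩ , changed j ≢ (π₁ ⟨ m , j ⟩) (π₂ ⟨ m , j ⟩) (π₁-⟨⟩ m j) (π₂-⟨⟩ m j)
      where
      changed : ∀ j → u ⟨ π₁ m , π₂ m + j ⟩ ≢ u ⟨ π₁ m , π₂ m ⟩ → ∀ m′ j′ → m′ ≡ m → j′ ≡ j →
                changeAt (u ⟨ π₁ m′ , π₂ m′ + j′ ⟩) (u ⟨ π₁ m′ , π₂ m′ ⟩) m′ ≡ suc m
      changed j ≢ _ _ refl refl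
        with distance (u ⟨ π₁ m , π₂ m + j ⟩) (u ⟨ π₁ m , π₂ m ⟩) in eq
      ... | zero  = ⊥-elim (≢ (distance≡0⇒≡ _ _ eq))
      ... | suc _ = refl

  -- The numbers y such that all m ≥ y listed by w are settled.  As w and changes u
  -- both list m by the value suc m, a common value suc m requires m < y; a common
  -- value 0 gives no condition.
  Bound : Baire → Baire → Pred ℕ 0ℓ
  Bound u w y = ∀ t j → w t ≡ changes u j → w t ≤ y

  -- Stage ⟨ y , ⟨ t , j ⟩ ⟩ of violations u w lists y if (t , j) witnesses that y
  -- is not in Bound u w.
  violation : ℕ → ℕ → ℕ → ℕ
  violation x x′ y = ifz (distance x x′ + (suc y ∸ x)) (suc y) 0

  violations : Baire → Baire → Baire
  violations u w i = violation (w (π₁ (π₂ i))) (changes u (π₂ (π₂ i))) (π₁ i)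

  -- The oracle is ⟪ u , w ⟫.
  violationsₜ : Total 1
  violationsₜ = ifzₜ (distanceₜ (oddsₜ (π₁ₜ (π₂ₜ v0))) (changesₜ evensₜ (π₂ₜ (π₂ₜ v0)))
                       +ₜ (sucₜ (π₁ₜ v0) ∸ₜ oddsₜ (π₁ₜ (π₂ₜ v0))))
                     (sucₜ (π₁ₜ v0)) zeroₜ

  violations-correct : ∀ z n → Eval z (prog violationsₜ) (n ∷ []) (violations (evens z) (odds z) n)
  violations-correct z n = correct violationsₜ z (n ∷ [])

  violations-name : ∀ u w → rel (graph (δ (𝒜ℕ em))) (violations u w) (Bound u w)
  violations-name u w y = mk⇔ (λ (i , e) → sound _ _ (π₁ i) e (π₁ (π₂ i)) (π₂ (π₂ i)) refl refl) complete
    where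
    sound : ∀ x x′ y′ → violation x x′ y′ ≡ suc y →
            ∀ t j → w t ≡ x → changes u j ≡ x′ → y ∉ Bound u w
    sound x x′ y′ e t j refl refl bound with distance x x′ + (suc y′ ∸ x) in eq
    sound x x′ y′ refl t j refl refl bound | zero =
      <⇒≱ (m∸n≡0⇒m≤n (m+n≡0⇒n≡0 (distance x x′) eq))
          (bound t j (distance≡0⇒≡ x x′ (m+n≡0⇒m≡0 _ eq)))
    complete : y ∉ Bound u w → violations u w lists y
    complete unbounded =
      let t , j , eq , ≰ = stable λ ∄ → unbounded λ t j eq → stable λ ≰ → ∄ (t , j , eq , ≰)
      in ⟨ y , ⟨ t , j ⟩ ⟩ , violated t j eq ≰ (π₁-⟨⟩ y ⟨ t , j ⟩)
           (trans (cong π₁ (π₂-⟨⟩ y ⟨ t , j ⟩)) (π₁-⟨⟩ t j))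
           (trans (cong π₂ (π₂-⟨⟩ y ⟨ t , j ⟩)) (π₂-⟨⟩ t j))
      where
      violated : ∀ t j → w t ≡ changes u j → ¬ w t ≤ y → ∀ {y′ t′ j′} → y′ ≡ y → t′ ≡ t → j′ ≡ j →
                 violation (w t′) (changes u j′) y′ ≡ suc y
      violated t j eq ≰ refl refl refl = cong (λ d → ifz d (suc y) 0) (cong₂ _+_
        (trans (cong (λ x → distance x (changes u j)) eq) (distance-0 (changes u j)))
        (m≤n⇒m∸n≡0 (≰⇒> ≰)))

  -- Zero iff x = suc m for some m ≥ y that codes a pair with first component n.
  misfit : ℕ → ℕ → ℕ → ℕ
  misfit y x n = (suc y ∸ x) + distance (π₁ (pred x)) n

  -- The oracle is ⟪ ⟪ u , w ⟫ , q ⟫, and q 0 is its value at 1.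
  uₜ wₜ : Total n → Total n
  uₜ a = evensₜ (a +ₜ a)
  wₜ a = evensₜ (sucₜ (a +ₜ a))

  foundₜ valueₜ : Total 2
  foundₜ = (sucₜ (ask (sucₜ zeroₜ)) ∸ₜ wₜ v0) +ₜ distanceₜ (π₁ₜ (predₜ (wₜ v0))) v1
  valueₜ = uₜ (pairₜ v1 (π₂ₜ (predₜ (wₜ v0))))

  -- For given n, find t with w t = suc m, m ≥ q 0 and m coding a pair (n , k);
  -- return u(n,k).
  evaluator : Machine
  evaluator = search foundₜ valueₜ

  evaluator-finds : ∀ z q n {s} → misfit (q 0) (odds z s) n ≡ 0 →
    ∃[ t ] misfit (q 0) (odds z t) n ≡ 0 ×
           Eval ⟪ z , q ⟫ evaluator (n ∷ []) (evens z ⟨ n , π₂ (pred (odds z t)) ⟩)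
  evaluator-finds z q n {s} eq =
    let t , eq′ , d = search-finds foundₜ valueₜ ⟪ z , q ⟫ (n ∷ []) {s}
                        (trans (cong (λ x → misfit (q 0) x n) (w≡ s)) eq)
    in t , trans (cong (λ x → misfit (q 0) x n) (sym (w≡ t))) eq′ ,
       subst (Eval ⟪ z , q ⟫ evaluator (n ∷ []))
         (trans (evens-⟪⟫ z q _) (cong (λ x → evens z ⟨ n , π₂ (pred x) ⟩) (w≡ t))) d
    where
    w≡ : ∀ t → evens ⟪ z , q ⟫ (suc (t + t)) ≡ odds z t
    w≡ t = evens-⟪⟫ z q (suc (t + t))

  -- The oracle z joins a sequence u with limit r and an enumeration w of a set V
  -- that agrees with the settled codes from b on.
  module LimitFromEnumeration {z r V b}
    (lim-r : rel (fun Lim) (evens z) r)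
    (wV : rel (graph (δ (𝒪ℕ em))) (odds z) V)
    (agree : ∀ m → m ∈ (λ m → (Settled (evens z) m × m ∉ V) ⊎ (m ∈ V × ¬ Settled (evens z) m)) → m < b)
    where

    u w : Baire
    u = evens z
    w = odds z

    b-bound : b ∈ Bound u w
    b-bound t j eq = go (w t) refl eq
      where
      go : ∀ x → w t ≡ x → x ≡ changes u j → x ≤ b
      go zero    _   _  = z≤n
      go (suc m) wt≡ eq = agree m (inj₂ (to (wV m) (t , wt≡) , to (changes-name u m) (j , sym eq)))

    bound-settled : ∀ {y} → y ∈ Bound u w → ∀ t m → w t ≡ suc m → y ≤ m → Settled u m
    bound-settled bound t m wt≡ y≤m = stable λ ¬settled →
      let j , e = from (changes-name u m) ¬settled
      in <⇒≱ (s≤s y≤m) (subst (_≤ _) wt≡ (bound t j (trans wt≡ (sym e))))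

    settled-value : ∀ {n} m → Settled u m → π₁ m ≡ n → u ⟨ n , π₂ m ⟩ ≡ r n
    settled-value m settled refl =
      let k , e = lim-r (π₁ m) in trans (sym (settled k)) (e (π₂ m + k) (m≤n+m k (π₂ m)))

    settled-above : ∀ n y → ∃[ m ] y ≤ m × b ≤ m × π₁ m ≡ n × Settled u m
    settled-above n y =
      ⟨ n , i ⟩ , ≤-trans (m≤n⊔m c y) (≤-trans (m≤m⊔n (c ⊔ y) b) (π₂≤⟨⟩ n i)) ,
      ≤-trans (m≤n⊔m (c ⊔ y) b) (π₂≤⟨⟩ n i) , π₁-⟨⟩ n i ,
      settled (π₁ ⟨ n , i ⟩) (π₂ ⟨ n , i ⟩) (π₁-⟨⟩ n i) (π₂-⟨⟩ n i)
      where
      c : ℕ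
      c = proj₁ (lim-r n)
      i : ℕ
      i = c ⊔ y ⊔ b
      e = proj₂ (lim-r n)
      c≤i : c ≤ i
      c≤i = ≤-trans (m≤m⊔n c y) (m≤m⊔n (c ⊔ y) b)
      settled : ∀ n′ i′ → n′ ≡ n → i′ ≡ i → ∀ j → u ⟨ n′ , i′ + j ⟩ ≡ u ⟨ n′ , i′ ⟩
      settled _ _ refl refl j = trans (e (i + j) (≤-trans c≤i (m≤m+n i j))) (sym (e i c≤i))

    evaluates : ∀ q → q 0 ∈ Bound u w → rel (graph ⟦ evaluator ⟧) ⟪ z , q ⟫ r
    evaluates q bound n =
      let m , y≤m , b≤m , π₁m≡n , settled = settled-above n (q 0)
          Vm = stable λ ¬Vm → <⇒≱ (agree m (inj₁ (settled , ¬Vm))) b≤m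
          s , ws≡ = from (wV m) Vm
          t , eq , d = evaluator-finds z q n {s} (trans (cong (λ x → misfit (q 0) x n) ws≡)
            (cong₂ _+_ (m≤n⇒m∸n≡0 y≤m)
              (trans (cong (λ x → distance x n) π₁m≡n) (distance-0 n))))
      in subst (Eval ⟪ z , q ⟫ evaluator (n ∷ [])) (value t (w t) refl eq) d
      where
      value : ∀ t x → w t ≡ x → misfit (q 0) x n ≡ 0 → u ⟨ n , π₂ (pred x) ⟩ ≡ r n
      value t (suc m) wt≡ eq = settled-value m
        (bound-settled bound t m wt≡ (m∸n≡0⇒m≤n (m+n≡0⇒m≡0 (q 0 ∸ m) eq)))
        (distance≡0⇒≡ _ _ (m+n≡0⇒n≡0 (q 0 ∸ m) eq))

  -- S computes from z an index of the function that the evaluator computes with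
  -- parameter z.
  module _ (S : Machine) (total : ∀ p → p ∈ dom (graph ⟦ S ⟧))
    (S-spec : ∀ p s → rel (graph ⟦ S ⟧) p s →
              ∀ q r → rel (graph (Φ U s)) q r ⇔ rel (graph ⟦ evaluator ⟧) ⟪ p , q ⟫ r) where

    indexₜ : Total 1
    fun     indexₜ p (n ∷ []) = proj₁ (total p) n
    prog    indexₜ            = S
    correct indexₜ p (n ∷ []) = proj₂ (total p) n

    -- The index names the first component of a solution, and the violations name
    -- the second.
    postprocess : Total 1
    postprocess = interleaveₜ indexₜ violationsₜ

    index : Baire → Baire
    index z = proj₁ (total z)

    postprocess-correct : ∀ z → rel (graph ⟦ prog postprocess ⟧) z
                                   ⟪ index z , violations (evens z) (odds z) ⟫
    postprocess-correct z n = correct postprocess z (n ∷ [])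

    solves : ∀ {p x w V} → p ≗ x → x ∈ dom (fun Lim) → rel (graph (δ (𝒪ℕ em))) w V →
      rel (fun (AlmostEC em)) (Settled p) V →
      rel (fun Implication) x (ℳ-element (index ⟪ p , w ⟫) ,
                               Bound (evens ⟪ p , w ⟫) (odds ⟪ p , w ⟫))
    solves {p} {x} {w} {V} p≗x (r , lim-r) wV almost =
      solution {u = x} {v = r} {s = index z} {B = Bound u′ w′} {y = proj₁ bounded} L.b-bound lim-r
        (λ q bound → from (S-spec z (index z) (proj₂ (total z)) q r) (L.evaluates q bound))
      where
      z u′ w′ : Baire
      z  = ⟪ p , w ⟫
      u′ = evens z
      w′ = odds z
      p≗u′ : p ≗ u′
      p≗u′ n = sym (evens-⟪⟫ p w n)
      settled-resp : ∀ {u v : Baire} → u ≗ v → ∀ m → Settled u m → Settled v m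
      settled-resp u≗v m settled j = trans (sym (u≗v _)) (trans (settled j) (u≗v _))
      bounded = finite-bounded (resp (fun (AlmostEC em)) {x = Settled p} {x′ = Settled u′} {y = V} {y′ = V}
        ((λ {m} → settled-resp p≗u′ m) , (λ {m} → settled-resp (λ n → sym (p≗u′ n)) m)) (id , id) almost)
      module L = LimitFromEnumeration {z} {r} {V} {proj₁ bounded}
        (resp (fun Lim) {x = x} {x′ = u′} {y = r} (λ n → trans (sym (p≗x n)) (p≗u′ n)) (λ _ → refl) lim-r)
        (resp (graph (δ (𝒪ℕ em))) {y = V} (λ n → sym (odds-⟪⟫ p w n)) (id , id) wV)
        (proj₂ bounded)

    reduction : Implication ≤W AlmostEC em
    reduction = ⟦ prog postprocess ⟧ , ⟦ prog (changesₜ ask v0) ⟧ ,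
      (prog postprocess , λ _ _ r → r) , (prog (changesₜ ask v0) , λ _ _ r → r) ,
      λ G G⊢ p x p≗x (_ , x∈dom , _) →
        let w , Gw , V , wV , almost = G⊢ (changes p) (Settled p) (changes-name p) total-dom
            z = ⟪ p , w ⟫
        in ⟪ index z , violations (evens z) (odds z) ⟫ ,
           ∘-defined ⟦ prog postprocess ⟧ G ⟦ prog (changesₜ ask v0) ⟧
             (changes-correct p) Gw (postprocess-correct z) ,
           (ℳ-element (index z) , Bound (evens z) (odds z)) ,
           (index z , violations (evens z) (odds z) , (λ _ → refl) , (λ _ _ → mk⇔ id id) ,
            violations-name (evens z) (odds z)) ,
           solves p≗x x∈dom wV almost
      where
      total-dom : ∀ {A} → A ∈ dom (fun (AlmostEC em))
      total-dom {A} = A , [] , λ { n (inj₁ (An , ¬An)) → ⊥-elim (¬An An)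
                                  ; n (inj₂ (An , ¬An)) → ⊥-elim (¬An An) }

  implication≤AlmostEC : Implication ≤W AlmostEC em
  implication≤AlmostEC with S , total , S-spec ← universal evaluator = reduction S total S-spec

proposition6p2 : (em : ExcludedMiddle 0ℓ) (U : Machine) → Universal U →
    AlmostEC em ≡W implication U (Cℕ em) (Cℕ-dom-nonempty em) Lim
proposition6p2 em U universal = AlmostEC≤implication , implication≤AlmostEC
  where open Proof em U universal
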